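{- Let $$A=\sum_{n\ge 0}t^n\sum_{\sigma\in\mathcal S_n(132)}y^{\mathrm{des}(\sigma)}x_1^{123\text{ -mch}(\sigma)}x_2^{213\text{ -mch}(\sigma)}x_3^{231\text{ -mch}(\sigma)}x_4^{321\text{ -mch}(\sigma)} .$$ Then $A=N/D$, where $$D=2x_3 t y\,(-x_1 x_4 t+x_3 t+x_4)\,(-x_1x_4 ty+x_1+x_2 x_3 t y)$$ and $$\begin{aligned} N={}&2 x_1^2 x_3 x_4^2 t^4 y^2+2 x_1^2 x_3 x_4^2 t^3 y^2-2x_1^2 x_3 x_4 t^4 y^2-2 x_1^2 x_3 x_4 t^3 y-2 x_1^2x_3 x_4 t^2 y+x_1^2 x_3 t^3 y-x_1^2 x_4 t^3 y+x_1^2t^2\\ &-2 x_1 x_2 x_3^2 x_4 t^4 y^2-2 x_1 x_2 x_3^2x_4 t^3 y^2+x_1 x_2 x_3^2 t^4 y^2+x_1 x_2 x_3x_4 t^4 y^2\\ &+(x_1 t-x_3 t-1) (x_3 t y-x_4 t y+1)\sqrt{(x_1 t+t y ((x_2-1) x_3 t-x_4)+1)^2-4 t (-x_1x_4t y+x_1+x_2 x_3 t y)}\\ &+x_1 x_2 x_3 t^3 y-2 x_1x_3^2 x_4 t^3 y^2+x_1 x_3^2 t^4 y^2+x_1 x_3^2 t^3 y+2x_1 x_3^2 t^2 y-2 x_1 x_3 x_4^2 t^4 y^2-2 x_1 x_3x_4^2 t^3 y^2\\ &-2 x_1 x_3 x_4^2 t^2 y^2+x_1 x_3 x_4t^4 y^2+3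 x_1 x_3 x_4 t^3 y^2+3 x_1 x_3 x_4 t^3 y+2x_1 x_3 x_4 t^2 y+2 x_1 x_3 x_4 t y\\ &-x_1 x_3t^3 y-2 x_1 x_3 t^2 y-x_1 x_3 t^2-x_1 x_4^2 t^3 y^2+3x_1 x_4 t^2 y-2 x_1 t\\ &+x_2 x_3^3 t^4 y^2+2 x_2 x_3^3t^3 y^2+x_2 x_3^2 x_4 t^4 y^2+2 x_2 x_3^2 x_4 t^3 y^2+2x_2 x_3^2 x_4 t^2 y^2-2 x_2 x_3^2 t^4 y^2-x_2 x_3^2t^3 y^2\\ &-x_2 x_3^2 t^3 y-x_2 x_3 x_4 t^3 y^2-x_2 x_3t^2 y-x_3^3 t^4 y^2+x_3^2 x_4 t^4 y^2-x_3^2 x_4 t^3y^2-x_3^2 t^3 y^2-x_3^2 t^3 y+x_3^2 t^2 y\\ &+x_3 x_4^2 t^3y^2+x_3 x_4 t^3 y^2-x_3 x_4 t^2 y^2-2 x_3 x_4 t^2y-x_3 t^2 y+x_3 t y+x_3 t+x_4^2 t^2 y^2-2 x_4 t y+1 . \end{aligned}$$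
   Context: $\mathcal S_n$ is the set of permutations of $\{1,\dots,n\}$ in one-line notation ($\mathcal S_0$ contains only the empty permutation, on which all statistics are $0$). For a word $w$ of distinct integers, $\mathrm{red}(w)$ replaces the $i$-th smallest letter by $i$. $\sigma\in\mathcal S_n$ avoids $\lambda\in\mathcal S_k$ (classical avoidance) if no (not necessarily contiguous) subsequence $\sigma_{i_1}\cdots\sigma_{i_k}$, $i_1<\dots<i_k$, has reduction $\lambda$; $\mathcal S_n(\lambda)$ is the set of such $\sigma$. $\gamma\text{ -mch}(\sigma)$ is the number of $i$ with $\mathrm{red}(\sigma_i\sigma_{i+1}\cdots\sigma_{i+k-1})=\gamma$ for $\gamma\in\mathcal S_k$. $\mathrm{des}(\sigma)=|\{i:\sigma_i>\sigma_{i+1}\}|$. The identity is in the fraction field of $\mathbb Q[y,x_1,x_2,x_3,x_4][[t]]$; the square root is the power series in $t$ with constant term $1$. -}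

module Defs where

open import Algebra.Bundles using (RawRing)
import Algebra.Definitions.RawSemiring as RawSemiringDefs
open import Data.Bool.Base using (if_then_else_)
open import Data.Fin.Base using (Fin; toℕ)
open import Data.Fin.Patterns using (0F; 1F; 2F; 3F; 4F)
open import Data.List.Base
  using (List; []; _∷_; _++_; cartesianProductWith; drop; filter; foldr; length; map; tails; take; upTo; zip)
open import Data.List.Properties using (≡-dec)
open import Data.List.Relation.Unary.All using (All; all?)
open import Data.List.Relation.Unary.Unique.DecPropositional using (unique?)
open import Data.Nat.Base using (ℕ; zero; suc; _∸_)
import Data.Nat.Base as ℕ
import Data.Nat.Properties as ℕ
open import Data.Product.Base using (_×_; _,_)
open import Data.Rational.Base using (ℚ; 0ℚ; 1ℚ)
import Data.Rational.Base as ℚ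
open import Data.Vec.Base using (Vec; replicate; zipWith; _[_]≔_)
import Data.Vec.Base as Vec
import Data.Vec.Properties as Vec
open import Level using (Level; 0ℓ; _⊔_)
open import Relation.Binary.PropositionalEquality using (_≡_; _≢_)
open import Relation.Nullary using (Dec; does; ¬?)

private variable
  c ℓ : Level

-- Permutations and patterns are words over ℕ in one-line notation.
Word : Set
Word = List ℕ

words : List ℕ → ℕ → List Word
words alphabet zero    = [] ∷ []
words alphabet (suc k) = cartesianProductWith _∷_ alphabet (words alphabet k)

𝒮 : ℕ → List Word
𝒮 n = filter (unique? ℕ._≟_) (words (map suc (upTo n)) n)

-- For a word of distinct letters, the i-th smallest letter has exactly i ∸ 1
-- letters below it.
red : Word → Word
red w = map (λ a → suc (length (filter (ℕ._<? a) w))) w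

subsequences : Word → List Word
subsequences []      = [] ∷ []
subsequences (a ∷ w) = map (a ∷_) (subsequences w) ++ subsequences w

Avoids : Word → Word → Set
Avoids γ σ = All (λ w → red w ≢ γ) (subsequences σ)

avoids? : ∀ γ σ → Dec (Avoids γ σ)
avoids? γ σ = all? (λ w → ¬? (≡-dec ℕ._≟_ (red w) γ)) (subsequences σ)

𝒮⟨_⟩ : Word → ℕ → List Word
𝒮⟨ γ ⟩ n = filter (avoids? γ) (𝒮 n)

-- For nonempty γ, suffixes of σ shorter than γ never count, since red
-- preserves length.
_-mch : Word → Word → ℕ
(γ -mch) σ = length (filter (λ w → ≡-dec ℕ._≟_ (red (take (length γ) w)) γ) (tails σ))

des : Word → ℕ
des σ = length (filter (λ (a , b) → b ℕ.<? a) (zip σ (drop 1 σ)))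

-- A polynomial is a formal sum of terms (coefficient , exponents); the same
-- exponents may occur repeatedly, so equality compares collected coefficients.
Poly : ℕ → Set
Poly k = List (ℚ × Vec ℕ k)

coeff : ∀ {k} → Poly k → Vec ℕ k → ℚ
coeff p e = foldr (λ (q , d) r → (if does (Vec.≡-dec ℕ._≟_ d e) then q else 0ℚ) ℚ.+ r) 0ℚ p

polyRing : ℕ → RawRing 0ℓ 0ℓ
polyRing k = record
  { Carrier = Poly k
  ; _≈_     = λ p q → ∀ e → coeff p e ≡ coeff q e
  ; _+_     = _++_
  ; _*_     = cartesianProductWith λ (q , d) (r , e) → q ℚ.* r , zipWith ℕ._+_ d e
  ; -_      = map λ (q , d) → ℚ.- q , d
  ; 0#      = []
  ; 1#      = (1ℚ , replicate k 0) ∷ []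
  }

var : ∀ {k} → Fin k → Poly k
var {k} i = (1ℚ , replicate k 0 [ i ]≔ 1) ∷ []

module _ (R : RawRing c ℓ) where
  open RawRing R
  open RawSemiringDefs rawSemiring using (sum)

  constant : Carrier → ℕ → Carrier
  constant a zero    = a
  constant a (suc _) = 0#

  indeterminate : ℕ → Carrier
  indeterminate 1 = 1#
  indeterminate _ = 0#

  seriesRing : RawRing c ℓ
  seriesRing = record
    { Carrier = ℕ → Carrier
    ; _≈_     = λ f g → ∀ n → f n ≈ g n
    ; _+_     = λ f g n → f n + g n
    ; _*_     = λ f g n → sum {suc n} λ i → f (toℕ i) * g (n ∸ toℕ i)
    ; -_      = λ f n → - f n
    ; 0#      = λ _ → 0#
    ; 1#      = constant 1#
    }

  -- The normalisation of the constant term singles out one of the two roots.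
  IsSquareRoot : (f s : ℕ → Carrier) → Set ℓ
  IsSquareRoot f s = s *ₛ s ≈ₛ f × s 0 ≈ 1#
    where open RawRing seriesRing using () renaming (_*_ to _*ₛ_; _≈_ to _≈ₛ_)

module Fractions (R : RawRing c ℓ) where
  open RawRing R

  infix 4 _≃_

  record Fraction : Set (c ⊔ ℓ) where
    constructor fraction
    field
      num   : Carrier
      den   : Carrier
      den≉0 : den ≉ 0#

  open Fraction public

  _≃_ : Fraction → Fraction → Set ℓ
  p ≃ q = num p * den q ≈ num q * den p

ℚ[y,x₁,x₂,x₃,x₄] : RawRing 0ℓ 0ℓ
ℚ[y,x₁,x₂,x₃,x₄] = polyRing 5

ℚ[y,x₁,x₂,x₃,x₄]⟦t⟧ : RawRing 0ℓ 0ℓ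
ℚ[y,x₁,x₂,x₃,x₄]⟦t⟧ = seriesRing ℚ[y,x₁,x₂,x₃,x₄]

open Fractions ℚ[y,x₁,x₂,x₃,x₄]⟦t⟧ public

module _ where
  open RawRing ℚ[y,x₁,x₂,x₃,x₄]
  open RawSemiringDefs rawSemiring using (_^_)

  weight : Word → Carrier
  weight σ = var 0F ^ des σ
    * var 1F ^ ((1 ∷ 2 ∷ 3 ∷ []) -mch) σ
    * var 2F ^ ((2 ∷ 1 ∷ 3 ∷ []) -mch) σ
    * var 3F ^ ((2 ∷ 3 ∷ 1 ∷ []) -mch) σ
    * var 4F ^ ((3 ∷ 2 ∷ 1 ∷ []) -mch) σ

  A : ℕ → Carrier
  A n = foldr _+_ 0# (map weight (𝒮⟨ 1 ∷ 3 ∷ 2 ∷ [] ⟩ n))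

open RawRing ℚ[y,x₁,x₂,x₃,x₄]⟦t⟧
open RawSemiringDefs rawSemiring using (_^_) renaming (_×_ to _·_)

infixl 6 _-_
_-_ : Carrier → Carrier → Carrier
f - g = f + - g

t y x₁ x₂ x₃ x₄ : Carrier
t  = indeterminate ℚ[y,x₁,x₂,x₃,x₄]
y  = constant ℚ[y,x₁,x₂,x₃,x₄] (var 0F)
x₁ = constant ℚ[y,x₁,x₂,x₃,x₄] (var 1F)
x₂ = constant ℚ[y,x₁,x₂,x₃,x₄] (var 2F)
x₃ = constant ℚ[y,x₁,x₂,x₃,x₄] (var 3F)
x₄ = constant ℚ[y,x₁,x₂,x₃,x₄] (var 4F)

Δ : Carrier
Δ = (x₁ * t + t * y * ((x₂ - 1#) * x₃ * t - x₄) + 1#) ^ 2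
  - 4 · t * (- (x₁ * x₄ * t * y) + x₁ + x₂ * x₃ * t * y)

D : Carrier
D = 2 · x₃ * t * y * (- (x₁ * x₄ * t) + x₃ * t + x₄) * (- (x₁ * x₄ * t * y) + x₁ + x₂ * x₃ * t * y)

N : (√Δ : Carrier) → Carrier
N √Δ =
    2 · x₁ ^ 2 * x₃ * x₄ ^ 2 * t ^ 4 * y ^ 2 + 2 · x₁ ^ 2 * x₃ * x₄ ^ 2 * t ^ 3 * y ^ 2
  - 2 · x₁ ^ 2 * x₃ * x₄ * t ^ 4 * y ^ 2 - 2 · x₁ ^ 2 * x₃ * x₄ * t ^ 3 * y
  - 2 · x₁ ^ 2 * x₃ * x₄ * t ^ 2 * y + x₁ ^ 2 * x₃ * t ^ 3 * y - x₁ ^ 2 * x₄ * t ^ 3 * y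
  + x₁ ^ 2 * t ^ 2 - 2 · x₁ * x₂ * x₃ ^ 2 * x₄ * t ^ 4 * y ^ 2
  - 2 · x₁ * x₂ * x₃ ^ 2 * x₄ * t ^ 3 * y ^ 2 + x₁ * x₂ * x₃ ^ 2 * t ^ 4 * y ^ 2
  + x₁ * x₂ * x₃ * x₄ * t ^ 4 * y ^ 2
  + (x₁ * t - x₃ * t - 1#) * (x₃ * t * y - x₄ * t * y + 1#) * √Δ + x₁ * x₂ * x₃ * t ^ 3 * y
  - 2 · x₁ * x₃ ^ 2 * x₄ * t ^ 3 * y ^ 2 + x₁ * x₃ ^ 2 * t ^ 4 * y ^ 2
  + x₁ * x₃ ^ 2 * t ^ 3 * y + 2 · x₁ * x₃ ^ 2 * t ^ 2 * y
  - 2 · x₁ * x₃ * x₄ ^ 2 * t ^ 4 * y ^ 2 - 2 · x₁ * x₃ * x₄ ^ 2 * t ^ 3 * y ^ 2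
  - 2 · x₁ * x₃ * x₄ ^ 2 * t ^ 2 * y ^ 2 + x₁ * x₃ * x₄ * t ^ 4 * y ^ 2
  + 3 · x₁ * x₃ * x₄ * t ^ 3 * y ^ 2 + 3 · x₁ * x₃ * x₄ * t ^ 3 * y
  + 2 · x₁ * x₃ * x₄ * t ^ 2 * y + 2 · x₁ * x₃ * x₄ * t * y - x₁ * x₃ * t ^ 3 * y
  - 2 · x₁ * x₃ * t ^ 2 * y - x₁ * x₃ * t ^ 2 - x₁ * x₄ ^ 2 * t ^ 3 * y ^ 2
  + 3 · x₁ * x₄ * t ^ 2 * y - 2 · x₁ * t + x₂ * x₃ ^ 3 * t ^ 4 * y ^ 2
  + 2 · x₂ * x₃ ^ 3 * t ^ 3 * y ^ 2 + x₂ * x₃ ^ 2 * x₄ * t ^ 4 * y ^ 2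
  + 2 · x₂ * x₃ ^ 2 * x₄ * t ^ 3 * y ^ 2 + 2 · x₂ * x₃ ^ 2 * x₄ * t ^ 2 * y ^ 2
  - 2 · x₂ * x₃ ^ 2 * t ^ 4 * y ^ 2 - x₂ * x₃ ^ 2 * t ^ 3 * y ^ 2 - x₂ * x₃ ^ 2 * t ^ 3 * y
  - x₂ * x₃ * x₄ * t ^ 3 * y ^ 2 - x₂ * x₃ * t ^ 2 * y - x₃ ^ 3 * t ^ 4 * y ^ 2
  + x₃ ^ 2 * x₄ * t ^ 4 * y ^ 2 - x₃ ^ 2 * x₄ * t ^ 3 * y ^ 2 - x₃ ^ 2 * t ^ 3 * y ^ 2
  - x₃ ^ 2 * t ^ 3 * y + x₃ ^ 2 * t ^ 2 * y + x₃ * x₄ ^ 2 * t ^ 3 * y ^ 2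
  + x₃ * x₄ * t ^ 3 * y ^ 2 - x₃ * x₄ * t ^ 2 * y ^ 2 - 2 · x₃ * x₄ * t ^ 2 * y
  - x₃ * t ^ 2 * y + x₃ * t * y + x₃ * t + x₄ ^ 2 * t ^ 2 * y ^ 2 - 2 · x₄ * t * y + 1#

1≉0 : 1# ≉ 0#
1≉0 eq with () ← eq 0 (replicate 5 0)

-- The monomial t y x₁ x₃ x₄ has coefficient 2 in D.
D≉0 : D ≉ 0#
D≉0 eq with () ← eq 1 (1 Vec.∷ 1 Vec.∷ 0 Vec.∷ 1 Vec.∷ 1 Vec.∷ Vec.[])

fromSeries : Carrier → Fraction
fromSeries f = fraction f 1# 1≉0

N/D : (√Δ : Carrier) → Fraction
N/D √Δ = fraction (N √Δ) D D≉0

{-# OPTIONS --safe #-}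
module Submission where

-- A nonempty 132-avoider is L m R, where m is its maximum and every letter of L exceeds every letter of R; so
-- 132-avoiders are binary trees. Descents and consecutive patterns lie in L m or in m R, except for the window
-- centred at m. Since the weight of L m depends on m only through "a larger letter follows", it suffices to count
-- blocks framed by larger letters on neither side (A), on the right (E), on the left (G), or on both sides, with
-- the left one smaller (H) or larger (K). In these five series the functional equations are polynomial: K is
-- quadratic, H - K = t y (x₂ - 1), and with U = 1 - t x₁ - t x₃ H and V = 1 - t y x₄ - t x₃ K the square root of Δ
-- is s = U + V - 1. Moreover (1 + x₃ E) U = P and (1 + x₃ G) V = Z are polynomials, whence
-- x₃ A = x₃ + t x₃ - t + t P Z / (U V), and U V (M - 2 t Q - s) = 2 t² y Q W clears the denominator.

-- The window centred at m sees only which of L and R are empty and which larger letters frame the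
-- block. Hence E, G, H and K count nonempty blocks, and every equation has one summand for each of
-- the four cases. H and K differ only on one-letter blocks, the only ones with a window that
-- contains both framing letters. The square root appears because 1 - U and V are the two roots of
-- X² - M X + t Q: Δ is the discriminant, s = V - (1 - U), and the constant terms 0 and 1 of the
-- roots fix the sign. U and V themselves are the denominators obtained when the linear equations
-- for E and G are solved. The variable x₃ has no inverse in the series ring, so the elimination
-- never divides. Instead A is multiplied by D, which supplies the factor x₃ as well as the 2 t y Q
-- W that is traded for a multiple of U V. The claim concerns every square root with constant term
-- 1. Two of them, r and r', satisfy (r - r') (r + r') = 0, and r + r' has constant term 2, which
-- can be cancelled over the rationals.

open import Algebra.Bundles using (CommutativeMonoid; CommutativeRing; RawRing)
import Algebra.Definitions.RawSemiring as RawSemiringDefs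
import Algebra.Properties.CommutativeSemigroup as CommutativeSemigroupProperties
import Algebra.Properties.Ring as RingProperties
import Algebra.Properties.Semiring.Exp as Exp
import Algebra.Properties.Semiring.Mult.TCOptimised as SemiringMult
import Algebra.Solver.Ring as RingSolver
open import Algebra.Solver.Ring.AlmostCommutativeRing using (fromCommutativeRing; _-Raw-AlmostCommutative⟶_)
open import Data.Bool.Base using (Bool; true; false; if_then_else_)
open import Data.Empty using (⊥)
open import Data.Fin.Patterns using (0F; 1F; 2F; 3F; 4F)
open import Data.Integer.Base as ℤ using (ℤ; +_; -[1+_]; +[1+_]; _⊖_; _◃_; 0ℤ; 1ℤ)
import Data.Integer.Properties as ℤ
open import Data.List.Base
  using (List; []; _∷_; _++_; cartesianProductWith; filter; foldr; length; map; tails; take; upTo)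
open import Data.List.Membership.Propositional using (_∈_; _∉_)
open import Data.List.Membership.Propositional.Properties
  using (∈-++⁺ˡ; ∈-++⁺ʳ; ∈-++⁻; ∈-map⁺; ∈-map⁻; ∈-upTo⁺; ∈-upTo⁻; ∈-filter⁺; ∈-filter⁻; ∈-∃++
        ; ∈-cartesianProductWith⁺; ∈-cartesianProductWith⁻)
open import Data.List.Membership.Propositional.Properties.WithK using (unique∧set⇒bag)
import Data.List.Properties as List
open import Data.List.Relation.Binary.BagAndSetEquality using (∼bag⇒↭)
open import Data.List.Relation.Binary.Disjoint.Propositional using (Disjoint)
open import Data.List.Relation.Binary.Permutation.Propositional as ↭ using (_↭_)
open import Data.List.Relation.Binary.Sublist.Propositional
  using (_⊆_; []; _∷_; _∷ʳ_; minimum; from∈; to∈; lookup)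
open import Data.List.Relation.Binary.Sublist.Propositional.Properties using (++⁺)
open import Data.List.Relation.Unary.All as All using (All; []; _∷_)
import Data.List.Relation.Unary.All.Properties as All
open import Data.List.Relation.Unary.AllPairs using (AllPairs; []; _∷_)
import Data.List.Relation.Unary.AllPairs.Properties as AllPairs
open import Data.List.Relation.Unary.Any using (here; there; any?)
import Data.List.Relation.Unary.Unique.DecPropositional as DecUnique
open import Data.List.Relation.Unary.Unique.Propositional using (Unique)
import Data.List.Relation.Unary.Unique.Propositional.Properties as Unique
open import Data.Maybe.Base using (Maybe; just; nothing)
open import Data.Nat.Base as ℕ using (ℕ; zero; suc; _<_; _≤_; _<ᵇ_; z≤n; s≤s; s<s; s≤s⁻¹; s<s⁻¹)
open import Data.Nat.Induction using (<-rec)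
import Data.Nat.Properties as ℕ
open import Data.Product.Base using (∃; ∃₂; _×_; _,_; proj₁; proj₂)
open import Data.Rational.Base as ℚ using (ℚ; 0ℚ; 1ℚ)
import Data.Rational.Properties as ℚ
import Data.Sign.Base as Sign
open import Data.Sum.Base using (_⊎_; inj₁; inj₂)
open import Data.Vec.Base as Vec using (Vec; []; _∷_; replicate; zipWith)
import Data.Vec.Properties as Vec
open import Function.Base using (_∘_)
open import Function.Bundles using (mk⇔)
open import Level using (0ℓ; _⊔_)
open import Relation.Binary.Core using (Rel)
open import Relation.Binary.Definitions using (tri<; tri≈; tri>)
open import Relation.Binary.PropositionalEquality as ≡ using (_≡_; _≢_; _≗_; module ≡-Reasoning)
import Relation.Binary.Reasoning.Setoid as SetoidReasoning
open import Relation.Nullary using (Dec; does; yes; no; contradiction)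
open import Relation.Nullary.Decidable using (dec-true; dec-false)

open import Defs
  using (Word; words; 𝒮; red; subsequences; Avoids; avoids?; 𝒮⟨_⟩; _-mch; des; coeff; polyRing
        ; constant; indeterminate; seriesRing; IsSquareRoot)

-- Solving ring equations with integer coefficients

module IntegerSolver {c ℓ} (R : CommutativeRing c ℓ) where
  open CommutativeRing R
  open RingProperties ring using (-0#≈0#; -‿involutive; -‿distribˡ-*; -‿distribʳ-*; -‿+-comm)
  open SemiringMult semiring using (1+×; ×-homo-+; ×1-homo-*) renaming (_×_ to _·_)
  open SetoidReasoning setoid

  private
    -- The multiple in use computes `1 · 1#` to `1#`, so the solver constants 0 and 1 denote `0#`
    -- and `1#` definitionally and solved equations close by `refl`.
    ⟦_⟧ℕ : ℕ → Carrier
    ⟦ n ⟧ℕ = n · 1#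

    ⟦_⟧ : ℤ → Carrier
    ⟦ + n ⟧      = ⟦ n ⟧ℕ
    ⟦ -[1+ n ] ⟧ = - ⟦ suc n ⟧ℕ

    ⊖-homo : ∀ m n → ⟦ m ⊖ n ⟧ ≈ ⟦ m ⟧ℕ - ⟦ n ⟧ℕ
    ⊖-homo zero    zero    = sym (-‿inverseʳ 0#)
    ⊖-homo zero    (suc n) = sym (+-identityˡ _)
    ⊖-homo (suc m) zero    = sym (trans (+-congˡ -0#≈0#) (+-identityʳ _))
    ⊖-homo (suc m) (suc n) = begin
      ⟦ suc m ⊖ suc n ⟧                ≡⟨ ≡.cong ⟦_⟧ (ℤ.[1+m]⊖[1+n]≡m⊖n m n) ⟩
      ⟦ m ⊖ n ⟧                        ≈⟨ ⊖-homo m n ⟩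
      ⟦ m ⟧ℕ - ⟦ n ⟧ℕ                  ≈⟨ +-congʳ (+-identityʳ _) ⟨
      ⟦ m ⟧ℕ + 0# - ⟦ n ⟧ℕ             ≈⟨ +-congʳ (+-congˡ (-‿inverseʳ 1#)) ⟨
      ⟦ m ⟧ℕ + (1# - 1#) - ⟦ n ⟧ℕ      ≈⟨ +-congʳ (+-assoc _ _ _) ⟨
      ⟦ m ⟧ℕ + 1# - 1# - ⟦ n ⟧ℕ        ≈⟨ +-assoc _ _ _ ⟩
      ⟦ m ⟧ℕ + 1# + (- 1# - ⟦ n ⟧ℕ)    ≈⟨ +-cong (+-comm _ _) (-‿+-comm _ _) ⟩
      1# + ⟦ m ⟧ℕ - (1# + ⟦ n ⟧ℕ)      ≈⟨ +-cong (1+× m 1#) (-‿cong (1+× n 1#)) ⟨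
      ⟦ suc m ⟧ℕ - ⟦ suc n ⟧ℕ          ∎

    ◃-homo : ∀ n → ⟦ Sign.- ◃ n ⟧ ≈ - ⟦ n ⟧ℕ
    ◃-homo zero    = sym -0#≈0#
    ◃-homo (suc n) = refl

    ⟦+◃_⟧ : ∀ n → ⟦ Sign.+ ◃ n ⟧ ≈ ⟦ n ⟧ℕ
    ⟦+◃ n ⟧ = reflexive (≡.cong ⟦_⟧ (ℤ.+◃n≡+n n))

    +-homo : ∀ i j → ⟦ i ℤ.+ j ⟧ ≈ ⟦ i ⟧ + ⟦ j ⟧
    +-homo (+ m)      (+ n)      = ×-homo-+ 1# m n
    +-homo (+ m)      -[1+ n ]   = ⊖-homo m (suc n)
    +-homo -[1+ m ]   (+ n)      = trans (⊖-homo n (suc m)) (+-comm _ _)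
    +-homo -[1+ m ]   -[1+ n ]   = begin
      - ⟦ suc (suc (m ℕ.+ n)) ⟧ℕ       ≡⟨ ≡.cong (λ k → - ⟦ suc k ⟧ℕ) (ℕ.+-suc m n) ⟨
      - ⟦ suc m ℕ.+ suc n ⟧ℕ           ≈⟨ -‿cong (×-homo-+ 1# (suc m) (suc n)) ⟩
      - (⟦ suc m ⟧ℕ + ⟦ suc n ⟧ℕ)      ≈⟨ -‿+-comm _ _ ⟨
      - ⟦ suc m ⟧ℕ - ⟦ suc n ⟧ℕ        ∎

    *-homo : ∀ i j → ⟦ i ℤ.* j ⟧ ≈ ⟦ i ⟧ * ⟦ j ⟧
    *-homo (+ m)    (+ n)    = trans ⟦+◃ m ℕ.* n ⟧ (×1-homo-* m n)
    *-homo (+ m)    -[1+ n ] = trans (◃-homo (m ℕ.* suc n))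
      (trans (-‿cong (×1-homo-* m (suc n))) (-‿distribʳ-* _ _))
    *-homo -[1+ m ] (+ n)    = trans (◃-homo (suc m ℕ.* n))
      (trans (-‿cong (×1-homo-* (suc m) n)) (-‿distribˡ-* _ _))
    *-homo -[1+ m ] -[1+ n ] = begin
      ⟦ suc m ℕ.* suc n ⟧ℕ             ≈⟨ ×1-homo-* (suc m) (suc n) ⟩
      ⟦ suc m ⟧ℕ * ⟦ suc n ⟧ℕ          ≈⟨ -‿involutive _ ⟨
      - - (⟦ suc m ⟧ℕ * ⟦ suc n ⟧ℕ)    ≈⟨ -‿cong (-‿distribˡ-* _ _) ⟩
      - (- ⟦ suc m ⟧ℕ * ⟦ suc n ⟧ℕ)    ≈⟨ -‿distribʳ-* _ _ ⟩
      - ⟦ suc m ⟧ℕ * - ⟦ suc n ⟧ℕ      ∎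

    -‿homo : ∀ i → ⟦ ℤ.- i ⟧ ≈ - ⟦ i ⟧
    -‿homo (+ zero)   = sym -0#≈0#
    -‿homo +[1+ n ]   = refl
    -‿homo -[1+ n ]   = sym (-‿involutive _)

    morphism : ℤ.+-*-rawRing -Raw-AlmostCommutative⟶ fromCommutativeRing R
    morphism = record
      { ⟦_⟧ = ⟦_⟧ ; +-homo = +-homo ; *-homo = *-homo ; -‿homo = -‿homo
      ; 0-homo = refl ; 1-homo = refl }

    -- Terms cancel in a normal form only if equality of coefficients can be tested. Series offer no
    -- such test; the integers do, and they map to every commutative ring.
    _≟_ : ∀ i j → Maybe (⟦ i ⟧ ≈ ⟦ j ⟧)
    i ≟ j with i ℤ.≟ j
    ... | yes ≡.refl = just refl
    ... | no  _      = nothing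

  open RingSolver ℤ.+-*-rawRing (fromCommutativeRing R) morphism _≟_ public
    using (solve; Polynomial; _:=_; _:+_; _:*_; _:-_; :-_; con)

  -- Formulas over an arbitrary raw ring can be read both in R and as syntax for the solver.
  syntaxRing : ℕ → RawRing _ _
  syntaxRing n = record
    { Carrier = Polynomial n ; _≈_ = _≡_ ; _+_ = _:+_ ; _*_ = _:*_ ; -_ = :-_
    ; 0# = con ℤ.0ℤ ; 1# = con ℤ.1ℤ }

-- Elimination

-- `Δ`, `D` and `N` are those of the statement with the ring made a parameter; over the series ring
-- they unfold to the originals.
module Formulas {c ℓ} (R : RawRing c ℓ) (t y x₁ x₂ x₃ x₄ : RawRing.Carrier R) where
  open RawRing R
  open RawSemiringDefs rawSemiring using (_^_) renaming (_×_ to _·_) public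

  infixl 6 _-_
  _-_ : Carrier → Carrier → Carrier
  f - g = f + - g

  Δ : Carrier
  Δ = (x₁ * t + t * y * ((x₂ - 1#) * x₃ * t - x₄) + 1#) ^ 2
    - 4 · t * (- (x₁ * x₄ * t * y) + x₁ + x₂ * x₃ * t * y)

  D : Carrier
  D = 2 · x₃ * t * y * (- (x₁ * x₄ * t) + x₃ * t + x₄) * (- (x₁ * x₄ * t * y) + x₁ + x₂ * x₃ * t * y)

  N : Carrier → Carrier
  N √Δ =
      2 · x₁ ^ 2 * x₃ * x₄ ^ 2 * t ^ 4 * y ^ 2 + 2 · x₁ ^ 2 * x₃ * x₄ ^ 2 * t ^ 3 * y ^ 2
    - 2 · x₁ ^ 2 * x₃ * x₄ * t ^ 4 * y ^ 2 - 2 · x₁ ^ 2 * x₃ * x₄ * t ^ 3 * y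
    - 2 · x₁ ^ 2 * x₃ * x₄ * t ^ 2 * y + x₁ ^ 2 * x₃ * t ^ 3 * y - x₁ ^ 2 * x₄ * t ^ 3 * y
    + x₁ ^ 2 * t ^ 2 - 2 · x₁ * x₂ * x₃ ^ 2 * x₄ * t ^ 4 * y ^ 2
    - 2 · x₁ * x₂ * x₃ ^ 2 * x₄ * t ^ 3 * y ^ 2 + x₁ * x₂ * x₃ ^ 2 * t ^ 4 * y ^ 2
    + x₁ * x₂ * x₃ * x₄ * t ^ 4 * y ^ 2
    + (x₁ * t - x₃ * t - 1#) * (x₃ * t * y - x₄ * t * y + 1#) * √Δ + x₁ * x₂ * x₃ * t ^ 3 * y
    - 2 · x₁ * x₃ ^ 2 * x₄ * t ^ 3 * y ^ 2 + x₁ * x₃ ^ 2 * t ^ 4 * y ^ 2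
    + x₁ * x₃ ^ 2 * t ^ 3 * y + 2 · x₁ * x₃ ^ 2 * t ^ 2 * y
    - 2 · x₁ * x₃ * x₄ ^ 2 * t ^ 4 * y ^ 2 - 2 · x₁ * x₃ * x₄ ^ 2 * t ^ 3 * y ^ 2
    - 2 · x₁ * x₃ * x₄ ^ 2 * t ^ 2 * y ^ 2 + x₁ * x₃ * x₄ * t ^ 4 * y ^ 2
    + 3 · x₁ * x₃ * x₄ * t ^ 3 * y ^ 2 + 3 · x₁ * x₃ * x₄ * t ^ 3 * y
    + 2 · x₁ * x₃ * x₄ * t ^ 2 * y + 2 · x₁ * x₃ * x₄ * t * y - x₁ * x₃ * t ^ 3 * y
    - 2 · x₁ * x₃ * t ^ 2 * y - x₁ * x₃ * t ^ 2 - x₁ * x₄ ^ 2 * t ^ 3 * y ^ 2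
    + 3 · x₁ * x₄ * t ^ 2 * y - 2 · x₁ * t + x₂ * x₃ ^ 3 * t ^ 4 * y ^ 2
    + 2 · x₂ * x₃ ^ 3 * t ^ 3 * y ^ 2 + x₂ * x₃ ^ 2 * x₄ * t ^ 4 * y ^ 2
    + 2 · x₂ * x₃ ^ 2 * x₄ * t ^ 3 * y ^ 2 + 2 · x₂ * x₃ ^ 2 * x₄ * t ^ 2 * y ^ 2
    - 2 · x₂ * x₃ ^ 2 * t ^ 4 * y ^ 2 - x₂ * x₃ ^ 2 * t ^ 3 * y ^ 2 - x₂ * x₃ ^ 2 * t ^ 3 * y
    - x₂ * x₃ * x₄ * t ^ 3 * y ^ 2 - x₂ * x₃ * t ^ 2 * y - x₃ ^ 3 * t ^ 4 * y ^ 2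
    + x₃ ^ 2 * x₄ * t ^ 4 * y ^ 2 - x₃ ^ 2 * x₄ * t ^ 3 * y ^ 2 - x₃ ^ 2 * t ^ 3 * y ^ 2
    - x₃ ^ 2 * t ^ 3 * y + x₃ ^ 2 * t ^ 2 * y + x₃ * x₄ ^ 2 * t ^ 3 * y ^ 2
    + x₃ * x₄ * t ^ 3 * y ^ 2 - x₃ * x₄ * t ^ 2 * y ^ 2 - 2 · x₃ * x₄ * t ^ 2 * y
    - x₃ * t ^ 2 * y + x₃ * t * y + x₃ * t + x₄ ^ 2 * t ^ 2 * y ^ 2 - 2 · x₄ * t * y + 1#

  -- `D` is 2 x₃ t y `W` `Q`, the coefficient of the root in `N` is minus `P` `Z`, and `M` is the
  -- expression squared in `Δ`, so that `Δ` is `M`² - 4 t `Q`.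
  Q W P Z M : Carrier
  Q = x₁ - x₁ * x₄ * t * y + x₂ * x₃ * t * y
  W = x₄ + x₃ * t - x₁ * x₄ * t
  P = 1# + x₃ * t - x₁ * t
  Z = 1# + x₃ * t * y - x₄ * t * y
  M = 1# + x₁ * t - x₄ * t * y + t * t * y * (x₂ - 1#) * x₃

  N-factored : Carrier → Carrier
  N-factored s = 2 · (t * y * W * Q) * (x₃ + t * x₃ - t) + P * Z * (M - 2 · (t * Q)) - P * Z * s

  U V : Carrier → Carrier
  U H = 1# - t * x₁ - t * x₃ * H
  V K = 1# - t * y * x₄ - t * x₃ * K

  record Equations (A E G H K : Carrier) : Set ℓ where
    field
      A-eq : A ≈ 1# + t * (1# + E + G + x₃ * (E * G))
      E-eq : E ≈ t * (1# + x₁ * E + H + x₃ * (E * H))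
      G-eq : G ≈ t * (y + K + y * x₄ * G + x₃ * (K * G))
      H-eq : H ≈ t * (y * x₂ + x₁ * K + y * x₄ * H + x₃ * (K * H))
      K-eq : K ≈ t * (y + x₁ * K + y * x₄ * H + x₃ * (K * H))

  -- Quantifying over `s′` spares a congruence proof for the long expression `N`; the replacement of
  -- `s` happens in `N-factored`, where the root occurs once.
  Solution : (A s : Carrier) → Set (c ⊔ ℓ)
  Solution A s = s * s ≈ Δ × (∀ {s′} → s′ ≈ s → A * D ≈ N s′)

Solvable : ∀ {c ℓ} → RawRing c ℓ → Set (c ⊔ ℓ)
Solvable S = ∀ t y x₁ x₂ x₃ x₄ A E G H K (let open Formulas S t y x₁ x₂ x₃ x₄) →
  Equations A E G H K → Solution A (RawRing._+_ S (U H) (V K) - RawRing.1# S)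

module System {c ℓ} (R : CommutativeRing c ℓ) where
  open CommutativeRing R hiding (_-_)
  open IntegerSolver R
  open SetoidReasoning setoid
  private
    1ₛ : ∀ {n} → Polynomial n
    1ₛ = con ℤ.1ℤ

    module Syntax n = Formulas (syntaxRing n)

  module Elimination (t y x₁ x₂ x₃ x₄ A E G H K : Carrier)
    (equations : Formulas.Equations rawRing t y x₁ x₂ x₃ x₄ A E G H K) where
    open Formulas rawRing t y x₁ x₂ x₃ x₄ hiding (U; V)
    open Equations equations
    private
      U  = Formulas.U rawRing t y x₁ x₂ x₃ x₄ H
      V  = Formulas.V rawRing t y x₁ x₂ x₃ x₄ K
      s₀ = U + V - 1#

    H-K : H ≈ K + t * y * (x₂ - 1#)
    H-K = begin
      H                                                            ≈⟨ H-eq ⟩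
      t * (y * x₂ + x₁ * K + y * x₄ * H + x₃ * (K * H))
        ≈⟨ solve 8 (λ t y x₁ x₂ x₃ x₄ H K →
             t :* (y :* x₂ :+ x₁ :* K :+ y :* x₄ :* H :+ x₃ :* (K :* H)) :=
             t :* (y :+ x₁ :* K :+ y :* x₄ :* H :+ x₃ :* (K :* H)) :+ t :* y :* (x₂ :- 1ₛ))
             refl t y x₁ x₂ x₃ x₄ H K ⟩
      t * (y + x₁ * K + y * x₄ * H + x₃ * (K * H)) + t * y * (x₂ - 1#) ≈⟨ +-congʳ K-eq ⟨
      K + t * y * (x₂ - 1#)                                        ∎

    M-UV : M ≈ 1# + V - U
    M-UV = begin
      M
        ≈⟨ solve 7 (λ t y x₁ x₂ x₃ x₄ K → let module S = Syntax 7 t y x₁ x₂ x₃ x₄ in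
             S.M := 1ₛ :+ (1ₛ :- t :* y :* x₄ :- t :* x₃ :* K)
               :- (1ₛ :- t :* x₁ :- t :* x₃ :* (K :+ t :* y :* (x₂ :- 1ₛ))))
             refl t y x₁ x₂ x₃ x₄ K ⟩
      1# + V - (1# - t * x₁ - t * x₃ * (K + t * y * (x₂ - 1#)))
        ≈⟨ +-congˡ (-‿cong (+-congˡ (-‿cong (*-congˡ H-K)))) ⟨
      1# + V - U ∎

    -- This is the product of the two roots and the place where the quadratic equation enters: the
    -- bracket after `t * x₃` is the right side of `K-eq` corrected by `H-K`, minus `H`, hence zero.
    tQ-UV : t * Q ≈ (1# - U) * V
    tQ-UV = begin
      t * Q
        ≈⟨ solve 8 (λ t y x₁ x₂ x₃ x₄ H K → let module S = Syntax 8 t y x₁ x₂ x₃ x₄ in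
             t :* S.Q :=
             (1ₛ :- (1ₛ :- t :* x₁ :- t :* x₃ :* H)) :* (1ₛ :- t :* y :* x₄ :- t :* x₃ :* K)
             :+ t :* x₃ :* (t :* (y :+ x₁ :* K :+ y :* x₄ :* H :+ x₃ :* (K :* H)) :+ t :* y :* (x₂ :- 1ₛ) :- H))
             refl t y x₁ x₂ x₃ x₄ H K ⟩
      (1# - U) * V + t * x₃ * (t * (y + x₁ * K + y * x₄ * H + x₃ * (K * H)) + t * y * (x₂ - 1#) - H)
        ≈⟨ +-congˡ (*-congˡ (+-congʳ (+-congʳ K-eq))) ⟨
      (1# - U) * V + t * x₃ * (K + t * y * (x₂ - 1#) - H)  ≈⟨ +-congˡ (*-congˡ (+-congʳ H-K)) ⟨
      (1# - U) * V + t * x₃ * (H - H)                      ≈⟨ +-congˡ (*-congˡ (-‿inverseʳ H)) ⟩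
      (1# - U) * V + t * x₃ * 0#                           ≈⟨ +-congˡ (zeroʳ _) ⟩
      (1# - U) * V + 0#                                    ≈⟨ +-identityʳ _ ⟩
      (1# - U) * V                                         ∎

    -- The identity (V - a)² = (V + a)² - 4 a V with a = 1 - U, in which the sum V + a is `M` and
    -- the product a V is `t * Q`.
    s₀²≈Δ : s₀ * s₀ ≈ Δ
    s₀²≈Δ = begin
      s₀ * s₀
        ≈⟨ solve 2 (λ U V → (U :+ V :- 1ₛ) :* (U :+ V :- 1ₛ) :=
             (1ₛ :+ V :- U) :* (1ₛ :+ V :- U) :- con (ℤ.+ 4) :* ((1ₛ :- U) :* V))
             refl U V ⟩
      (1# + V - U) * (1# + V - U) - 4# * ((1# - U) * V)
        ≈⟨ +-cong (*-cong M-UV M-UV) (-‿cong (*-congˡ tQ-UV)) ⟨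
      M * M - 4# * (t * Q)
        ≈⟨ solve 6 (λ t y x₁ x₂ x₃ x₄ → let module S = Syntax 6 t y x₁ x₂ x₃ x₄ in
             S.M :* S.M :- con (ℤ.+ 4) :* (t :* S.Q) := S.Δ) refl t y x₁ x₂ x₃ x₄ ⟩
      Δ ∎
      -- The left-nested sum is what `con (ℤ.+ 4)` denotes by computation.
      where 4# = 1# + 1# + 1# + 1#

    -- Solving `E-eq` gives E U = t (1 + H); adding x₃ times this to U cancels the term in H, which
    -- leaves a polynomial. For `Z-factors` the same happens with G V = t (y + K).
    P-factors : P ≈ (1# + x₃ * E) * U
    P-factors = begin
      P
        ≈⟨ solve 8 (λ t y x₁ x₂ x₃ x₄ E H → let module S = Syntax 8 t y x₁ x₂ x₃ x₄ in
             S.P := (1ₛ :+ x₃ :* E) :* (1ₛ :- t :* x₁ :- t :* x₃ :* H)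
               :+ x₃ :* (t :* (1ₛ :+ x₁ :* E :+ H :+ x₃ :* (E :* H)) :- E))
             refl t y x₁ x₂ x₃ x₄ E H ⟩
      (1# + x₃ * E) * U + x₃ * (t * (1# + x₁ * E + H + x₃ * (E * H)) - E)
        ≈⟨ +-congˡ (*-congˡ (+-congʳ E-eq)) ⟨
      (1# + x₃ * E) * U + x₃ * (E - E)  ≈⟨ +-congˡ (*-congˡ (-‿inverseʳ E)) ⟩
      (1# + x₃ * E) * U + x₃ * 0#       ≈⟨ +-congˡ (zeroʳ _) ⟩
      (1# + x₃ * E) * U + 0#            ≈⟨ +-identityʳ _ ⟩
      (1# + x₃ * E) * U                 ∎

    Z-factors : Z ≈ (1# + x₃ * G) * V
    Z-factors = begin
      Z
        ≈⟨ solve 8 (λ t y x₁ x₂ x₃ x₄ G K → let module S = Syntax 8 t y x₁ x₂ x₃ x₄ in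
             S.Z := (1ₛ :+ x₃ :* G) :* (1ₛ :- t :* y :* x₄ :- t :* x₃ :* K)
               :+ x₃ :* (t :* (y :+ K :+ y :* x₄ :* G :+ x₃ :* (K :* G)) :- G))
             refl t y x₁ x₂ x₃ x₄ G K ⟩
      (1# + x₃ * G) * V + x₃ * (t * (y + K + y * x₄ * G + x₃ * (K * G)) - G)
        ≈⟨ +-congˡ (*-congˡ (+-congʳ G-eq)) ⟨
      (1# + x₃ * G) * V + x₃ * (G - G)  ≈⟨ +-congˡ (*-congˡ (-‿inverseʳ G)) ⟩
      (1# + x₃ * G) * V + x₃ * 0#       ≈⟨ +-congˡ (zeroʳ _) ⟩
      (1# + x₃ * G) * V + 0#            ≈⟨ +-identityʳ _ ⟩
      (1# + x₃ * G) * V                 ∎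

    -- Modulo M = 1 + V − U and t Q = (1 − U) V, the last factor is 2 (1 − U) (1 − V) and t y W is U (1 − V).
    rationalised : U * V * (M - 2 · (t * Q) - s₀) ≈ 2 · (t * (t * y * W * Q))
    rationalised = begin
      U * V * (M - 2 · (t * Q) - s₀)
        ≈⟨ *-congˡ (+-congʳ (+-cong M-UV (-‿cong (+-cong tQ-UV (+-congʳ tQ-UV))))) ⟩
      U * V * (1# + V - U - 2 · ((1# - U) * V) - s₀)
        ≈⟨ solve 2 (λ U V → let q = (1ₛ :- U) :* V ; _·_ = RawSemiringDefs._×_ (RawRing.rawSemiring (syntaxRing 2)) in
             U :* V :* (1ₛ :+ V :- U :- 2 · q :- (U :+ V :- 1ₛ)) :=
             2 · (q :* (1ₛ :- (1ₛ :+ V :- U) :+ q))) refl U V ⟩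
      2 · ((1# - U) * V * (1# - (1# + V - U) + (1# - U) * V))
        ≈⟨ 2·-cong (*-cong tQ-UV (+-cong (+-congˡ (-‿cong M-UV)) tQ-UV)) ⟨
      2 · (t * Q * (1# - M + t * Q))
        ≈⟨ solve 6 (λ t y x₁ x₂ x₃ x₄ → let module S = Syntax 6 t y x₁ x₂ x₃ x₄ in
             (2 S.· (t :* S.Q :* (1ₛ :- S.M :+ t :* S.Q))) := (2 S.· (t :* (t :* y :* S.W :* S.Q)))) refl t y x₁ x₂ x₃ x₄ ⟩
      2 · (t * (t * y * W * Q)) ∎
      where
      2·-cong : ∀ {a b} → a ≈ b → 2 · a ≈ 2 · b
      2·-cong a≈b = +-cong a≈b (+-congʳ a≈b)

    AD≈N : ∀ {s} → s ≈ s₀ → A * D ≈ N s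
    AD≈N {s} s≈s₀ = begin
      A * D                                                   ≈⟨ *-congʳ A-eq ⟩
      (1# + t * (1# + E + G + x₃ * (E * G))) * D
        ≈⟨ solve 8 (λ t y x₁ x₂ x₃ x₄ E G → let module S = Syntax 8 t y x₁ x₂ x₃ x₄ in
             (1ₛ :+ t :* (1ₛ :+ E :+ G :+ x₃ :* (E :* G))) :* S.D :=
             (2 S.· (t :* y :* S.W :* S.Q)) :* (x₃ :+ t :* x₃ :- t)
             :+ (1ₛ :+ x₃ :* E) :* (1ₛ :+ x₃ :* G) :* ((2 S.· (t :* (t :* y :* S.W :* S.Q)))))
             refl t y x₁ x₂ x₃ x₄ E G ⟩
      2 · (t * y * W * Q) * (x₃ + t * x₃ - t) + Ê * Ĝ * (2 · (t * (t * y * W * Q)))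
        -- The product `U * V` created here is shared out between `Ê` and `Ĝ`, which turns them into
        -- `P` and `Z` and removes the unknown series.
        ≈⟨ +-congˡ (*-congˡ rationalised) ⟨
      2 · (t * y * W * Q) * (x₃ + t * x₃ - t) + Ê * Ĝ * (U * V * (M - 2 · (t * Q) - s₀))
        ≈⟨ solve 7 (λ B Ê Ĝ U V L s → B :+ Ê :* Ĝ :* (U :* V :* (L :- s)) :=
             B :+ Ê :* U :* (Ĝ :* V) :* L :- Ê :* U :* (Ĝ :* V) :* s)
             refl (2 · (t * y * W * Q) * (x₃ + t * x₃ - t)) Ê Ĝ U V (M - 2 · (t * Q)) s₀ ⟩
      2 · (t * y * W * Q) * (x₃ + t * x₃ - t) + Ê * U * (Ĝ * V) * (M - 2 · (t * Q)) - Ê * U * (Ĝ * V) * s₀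
        ≈⟨ +-cong (+-congˡ (*-congʳ PZ)) (-‿cong (*-congʳ PZ)) ⟨
      N-factored s₀    ≈⟨ +-congˡ (-‿cong (*-congˡ s≈s₀)) ⟨
      N-factored s
        ≈⟨ solve 7 (λ t y x₁ x₂ x₃ x₄ s → let module S = Syntax 7 t y x₁ x₂ x₃ x₄ in
             S.N-factored s := S.N s) refl t y x₁ x₂ x₃ x₄ s ⟩
      N s ∎
      where
      Ê = 1# + x₃ * E
      Ĝ = 1# + x₃ * G
      PZ = *-cong P-factors Z-factors

  solvable : Solvable rawRing
  solvable t y x₁ x₂ x₃ x₄ A E G H K equations = s₀²≈Δ , AD≈N
    where open Elimination t y x₁ x₂ x₃ x₄ A E G H K equations

-- Formal power series

module Series {c ℓ} (R : CommutativeRing c ℓ) where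
  open CommutativeRing R
  open RingProperties ring using (-0#≈0#)
  open SetoidReasoning setoid
  open RawRing (seriesRing rawRing) public using () renaming
    (_≈_ to _≈ₛ_; _+_ to _+ₛ_; _*_ to _*ₛ_; -_ to -ₛ_; 0# to 0ₛ; 1# to 1ₛ)
  private
    interchange = CommutativeSemigroupProperties.interchange
      (record { isCommutativeSemigroup = +-isCommutativeSemigroup })

    Series = ℕ → Carrier

    scale : Carrier → Series → Series
    scale a f n = a * f n

  -- The Cauchy product satisfies f g = f₀ g + t (tail f) g by computation, so the ring laws are proved by
  -- induction on the index for all series at once.
  *ₛ-cong : ∀ {f f′ g g′} → f ≈ₛ f′ → g ≈ₛ g′ → f *ₛ g ≈ₛ f′ *ₛ g′
  *ₛ-cong f≈ g≈ zero    = +-congʳ (*-cong (f≈ 0) (g≈ 0))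
  *ₛ-cong f≈ g≈ (suc n) = +-cong (*-cong (f≈ 0) (g≈ (suc n))) (*ₛ-cong (f≈ ∘ suc) g≈ n)

  *ₛ-zeroˡ : ∀ g → 0ₛ *ₛ g ≈ₛ 0ₛ
  *ₛ-zeroˡ g zero    = trans (+-identityʳ _) (zeroˡ _)
  *ₛ-zeroˡ g (suc n) = trans (+-cong (zeroˡ _) (*ₛ-zeroˡ g n)) (+-identityˡ 0#)

  *ₛ-distribʳ : ∀ h f g → (f +ₛ g) *ₛ h ≈ₛ f *ₛ h +ₛ g *ₛ h
  *ₛ-distribʳ h f g zero    = trans (+-congˡ (sym (+-identityˡ 0#)))
    (trans (+-congʳ (distribʳ _ _ _)) (interchange _ _ _ _))
  *ₛ-distribʳ h f g (suc n) = trans (+-cong (distribʳ _ _ _) (*ₛ-distribʳ h (f ∘ suc) (g ∘ suc) n))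
    (interchange _ _ _ _)

  *ₛ-scale : ∀ a f g → scale a f *ₛ g ≈ₛ scale a (f *ₛ g)
  *ₛ-scale a f g zero    = trans (+-cong (*-assoc _ _ _) (sym (zeroʳ a))) (sym (distribˡ _ _ _))
  *ₛ-scale a f g (suc n) = trans (+-cong (*-assoc _ _ _) (*ₛ-scale a (f ∘ suc) g n)) (sym (distribˡ _ _ _))

  *ₛ-assoc : ∀ f g h → (f *ₛ g) *ₛ h ≈ₛ f *ₛ (g *ₛ h)
  *ₛ-assoc f g h zero    = +-congʳ (begin
    (f 0 * g 0 + 0#) * h 0    ≈⟨ *-congʳ (+-identityʳ _) ⟩
    f 0 * g 0 * h 0           ≈⟨ *-assoc _ _ _ ⟩
    f 0 * (g 0 * h 0)         ≈⟨ *-congˡ (+-identityʳ _) ⟨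
    f 0 * (g 0 * h 0 + 0#)    ∎)
  *ₛ-assoc f g h (suc n) = begin
    (f 0 * g 0 + 0#) * h (suc n) + ((scale (f 0) (g ∘ suc) +ₛ (f ∘ suc) *ₛ g) *ₛ h) n
      ≈⟨ +-cong (trans (*-congʳ (+-identityʳ _)) (*-assoc _ _ _)) (*ₛ-distribʳ h (scale (f 0) (g ∘ suc)) ((f ∘ suc) *ₛ g) n) ⟩
    f 0 * (g 0 * h (suc n)) + ((scale (f 0) (g ∘ suc) *ₛ h) n + (((f ∘ suc) *ₛ g) *ₛ h) n)
      ≈⟨ +-congˡ (+-cong (*ₛ-scale (f 0) (g ∘ suc) h n) (*ₛ-assoc (f ∘ suc) g h n)) ⟩
    f 0 * (g 0 * h (suc n)) + (f 0 * ((g ∘ suc) *ₛ h) n + ((f ∘ suc) *ₛ (g *ₛ h)) n)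
      ≈⟨ trans (sym (+-assoc _ _ _)) (+-congʳ (sym (distribˡ _ _ _))) ⟩
    f 0 * (g *ₛ h) (suc n) + ((f ∘ suc) *ₛ (g *ₛ h)) n ∎

  -- The product recurses on its first factor by computation; commutativity needs this mirror
  -- recursion on the second.
  *ₛ-suc : ∀ f g n → (f *ₛ g) (suc n) ≈ (f *ₛ (g ∘ suc)) n + f (suc n) * g 0
  *ₛ-suc f g zero    = trans (+-congˡ (+-identityʳ _)) (+-congʳ (sym (+-identityʳ _)))
  *ₛ-suc f g (suc n) = trans (+-congˡ (*ₛ-suc (f ∘ suc) g n)) (sym (+-assoc _ _ _))

  *ₛ-comm : ∀ f g → f *ₛ g ≈ₛ g *ₛ f
  *ₛ-comm f g zero    = +-congʳ (*-comm _ _)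
  *ₛ-comm f g (suc n) = begin
    f 0 * g (suc n) + ((f ∘ suc) *ₛ g) n    ≈⟨ +-cong (*-comm _ _) (*ₛ-comm (f ∘ suc) g n) ⟩
    g (suc n) * f 0 + (g *ₛ (f ∘ suc)) n    ≈⟨ +-comm _ _ ⟩
    (g *ₛ (f ∘ suc)) n + g (suc n) * f 0    ≈⟨ *ₛ-suc g f n ⟨
    (g *ₛ f) (suc n)                        ∎

  constant-* : ∀ a f n → (constant rawRing a *ₛ f) n ≈ a * f n
  constant-* a f zero    = +-identityʳ _
  constant-* a f (suc n) = trans (+-congˡ (*ₛ-zeroˡ f n)) (+-identityʳ _)

  *ₛ-identityˡ : ∀ f → 1ₛ *ₛ f ≈ₛ f
  *ₛ-identityˡ f n = trans (constant-* 1# f n) (*-identityˡ _)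

  seriesCommutativeRing : CommutativeRing c ℓ
  seriesCommutativeRing = record
    { RawRing (seriesRing rawRing)
    ; isCommutativeRing = record
      { isRing = record
        { +-isAbelianGroup = record
          { isGroup = record
            { isMonoid = record
              { isSemigroup = record
                { isMagma = record
                  { isEquivalence = record
                    { refl  = λ _ → refl
                    ; sym   = λ f≈g n → sym (f≈g n)
                    ; trans = λ f≈g g≈h n → trans (f≈g n) (g≈h n)
                    }
                  ; ∙-cong = λ f≈ g≈ n → +-cong (f≈ n) (g≈ n)
                  }
                ; assoc = λ f g h n → +-assoc (f n) (g n) (h n)
                }
              ; identity = (λ f n → +-identityˡ (f n)) , (λ f n → +-identityʳ (f n))
              }
            ; inverse = (λ f n → -‿inverseˡ (f n)) , (λ f n → -‿inverseʳ (f n))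
            ; ⁻¹-cong = λ f≈ n → -‿cong (f≈ n)
            }
          ; comm = λ f g n → +-comm (f n) (g n)
          }
        ; *-cong = *ₛ-cong
        ; *-assoc = *ₛ-assoc
        ; *-identity = *ₛ-identityˡ , λ f n → trans (*ₛ-comm f 1ₛ n) (*ₛ-identityˡ f n)
        ; distrib = (λ f g h n → trans (*ₛ-comm f (g +ₛ h) n)
                      (trans (*ₛ-distribʳ f g h n) (+-cong (*ₛ-comm g f n) (*ₛ-comm h f n))))
                  , *ₛ-distribʳ
        }
      ; *-comm = *ₛ-comm
      }
    }

  indeterminate-suc : ∀ n → indeterminate rawRing (suc n) ≈ 1ₛ n
  indeterminate-suc zero    = refl
  indeterminate-suc (suc n) = refl

  shift-zero : ∀ f → (indeterminate rawRing *ₛ f) 0 ≈ 0#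
  shift-zero f = trans (+-identityʳ _) (zeroˡ _)

  shift-suc : ∀ f n → (indeterminate rawRing *ₛ f) (suc n) ≈ f n
  shift-suc f n = begin
    0# * f (suc n) + ((indeterminate rawRing ∘ suc) *ₛ f) n
      ≈⟨ +-cong (zeroˡ _) (*ₛ-cong {g = f} indeterminate-suc (λ _ → refl) n) ⟩
    0# + (1ₛ *ₛ f) n
      ≈⟨ trans (+-identityˡ _) (*ₛ-identityˡ f n) ⟩
    f n ∎

  -- Every other term of the Cauchy sum contains an earlier coefficient of `f`.
  *ₛ-leading : ∀ n f g → (∀ {i} → i < n → f i ≈ 0#) → (f *ₛ g) n ≈ f n * g 0
  *ₛ-leading zero    f g f≈0 = +-identityʳ _
  *ₛ-leading (suc n) f g f≈0 = begin
    f 0 * g (suc n) + ((f ∘ suc) *ₛ g) n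
      ≈⟨ +-cong (trans (*-congʳ (f≈0 (s≤s z≤n))) (zeroˡ _)) (*ₛ-leading n (f ∘ suc) g (f≈0 ∘ s<s)) ⟩
    0# + f (suc n) * g 0
      ≈⟨ +-identityˡ _ ⟩
    f (suc n) * g 0 ∎

  module _ (a+a≈0⇒a≈0 : ∀ a → a + a ≈ 0# → a ≈ 0#) where
    private module S = CommutativeRing seriesCommutativeRing

    -- By strong induction the first coefficient of `f` not yet known to vanish occurs doubled in
    -- the product, and the absence of 2-torsion kills it.
    *ₛ-cancel-zero : ∀ f g → g 0 ≈ 1# + 1# → f *ₛ g ≈ₛ 0ₛ → f ≈ₛ 0ₛ
    *ₛ-cancel-zero f g g₀≈2 fg≈0 = <-rec (λ n → f n ≈ 0#) λ n f≈0 → a+a≈0⇒a≈0 (f n) (begin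
      f n + f n              ≈⟨ +-cong (*-identityʳ _) (*-identityʳ _) ⟨
      f n * 1# + f n * 1#    ≈⟨ distribˡ _ _ _ ⟨
      f n * (1# + 1#)        ≈⟨ *-congˡ g₀≈2 ⟨
      f n * g 0              ≈⟨ *ₛ-leading n f g f≈0 ⟨
      (f *ₛ g) n             ≈⟨ fg≈0 n ⟩
      0#                     ∎)

    squareRoot-unique : ∀ {f r s} → IsSquareRoot rawRing f r → IsSquareRoot rawRing f s → r ≈ₛ s
    squareRoot-unique {f} {r} {s} (r²≈f , r₀≈1) (s²≈f , s₀≈1) =
      S.trans (S.sym (solve 2 (λ r s → r :- s :+ s := r) S.refl r s))
        (S.trans (S.+-congʳ r-s≈0) (S.+-identityˡ s))
      where
      open IntegerSolver seriesCommutativeRing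
      r-s≈0 : r +ₛ -ₛ s ≈ₛ 0ₛ
      r-s≈0 = *ₛ-cancel-zero (r +ₛ -ₛ s) (r +ₛ s) (+-cong r₀≈1 s₀≈1)
        (S.trans (solve 2 (λ r s → (r :- s) :* (r :+ s) := r :* r :- s :* s) S.refl r s)
          (S.trans (S.+-cong r²≈f (S.-‿cong s²≈f)) (S.-‿inverseʳ f)))

-- Polynomials

module Polynomials (k : ℕ) where
  open RawRing (polyRing k)
  open ≡-Reasoning
  private
    interchange = CommutativeSemigroupProperties.interchange
      (CommutativeMonoid.commutativeSemigroup ℚ.+-0-commutativeMonoid)

    _⊕_ : Vec ℕ k → Vec ℕ k → Vec ℕ k
    _⊕_ = zipWith ℕ._+_

    0ᵉ : Vec ℕ k
    0ᵉ = replicate k 0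

  -- The linear extension of φ from monomials to polynomials; collecting coefficients is the case of a
  -- Kronecker delta, and products turn into iterated extensions.
  extend : (Vec ℕ k → ℚ) → Carrier → ℚ
  extend φ []            = 0ℚ
  extend φ ((q , d) ∷ p) = q ℚ.* φ d ℚ.+ extend φ p

  δ : Vec ℕ k → Vec ℕ k → ℚ
  δ e d = if does (Vec.≡-dec ℕ._≟_ d e) then 1ℚ else 0ℚ

  coeff≡extend : ∀ p e → coeff p e ≡ extend (δ e) p
  coeff≡extend []            e = ≡.refl
  coeff≡extend ((q , d) ∷ p) e = ≡.cong₂ ℚ._+_ term (coeff≡extend p e)
    where
    term : (if does (Vec.≡-dec ℕ._≟_ d e) then q else 0ℚ) ≡ q ℚ.* δ e d
    term with does (Vec.≡-dec ℕ._≟_ d e)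
    ... | true  = ≡.sym (ℚ.*-identityʳ q)
    ... | false = ≡.sym (ℚ.*-zeroʳ q)

  extend-cong : ∀ {φ ψ} → φ ≗ ψ → extend φ ≗ extend ψ
  extend-cong φ≗ψ []            = ≡.refl
  extend-cong φ≗ψ ((q , d) ∷ p) = ≡.cong₂ (λ a b → q ℚ.* a ℚ.+ b) (φ≗ψ d) (extend-cong φ≗ψ p)

  extend-+ : ∀ φ p q → extend φ (p + q) ≡ extend φ p ℚ.+ extend φ q
  extend-+ φ []            q = ≡.sym (ℚ.+-identityˡ _)
  extend-+ φ ((a , d) ∷ p) q = ≡.trans (≡.cong (a ℚ.* φ d ℚ.+_) (extend-+ φ p q)) (≡.sym (ℚ.+-assoc (a ℚ.* φ d) _ _))

  extend-neg : ∀ φ p → extend φ (- p) ≡ ℚ.- extend φ p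
  extend-neg φ []            = ≡.refl
  extend-neg φ ((a , d) ∷ p) = ≡.trans (≡.cong₂ ℚ._+_ (≡.sym (ℚ.neg-distribˡ-* a (φ d))) (extend-neg φ p))
    (≡.sym (ℚ.neg-distrib-+ (a ℚ.* φ d) (extend φ p)))

  extend-* : ∀ φ p q → extend φ (p * q) ≡ extend (λ d → extend (λ e → φ (d ⊕ e)) q) p
  extend-* φ []            q = ≡.refl
  extend-* φ ((a , d) ∷ p) q = ≡.trans (extend-+ φ (map _ q) (p * q)) (≡.cong₂ ℚ._+_ (row q) (extend-* φ p q))
    where
    row : ∀ q → extend φ (map (λ (r , e) → a ℚ.* r , d ⊕ e) q) ≡ a ℚ.* extend (λ e → φ (d ⊕ e)) q
    row []            = ≡.sym (ℚ.*-zeroʳ a)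
    row ((r , e) ∷ q) = ≡.trans (≡.cong₂ ℚ._+_ (ℚ.*-assoc a r _) (row q)) (≡.sym (ℚ.*-distribˡ-+ a _ _))

  extend-linear : ∀ a φ ψ p → extend (λ d → a ℚ.* φ d ℚ.+ ψ d) p ≡ a ℚ.* extend φ p ℚ.+ extend ψ p
  extend-linear a φ ψ []            = ≡.sym (≡.trans (ℚ.+-identityʳ _) (ℚ.*-zeroʳ a))
  extend-linear a φ ψ ((b , d) ∷ p) = begin
    b ℚ.* (a ℚ.* φ d ℚ.+ ψ d) ℚ.+ extend (λ d → a ℚ.* φ d ℚ.+ ψ d) p
      ≡⟨ ≡.cong₂ ℚ._+_ (≡.trans (ℚ.*-distribˡ-+ b _ _) (≡.cong (ℚ._+ _) swap)) (extend-linear a φ ψ p) ⟩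
    (a ℚ.* (b ℚ.* φ d) ℚ.+ b ℚ.* ψ d) ℚ.+ (a ℚ.* extend φ p ℚ.+ extend ψ p)
      ≡⟨ interchange (a ℚ.* (b ℚ.* φ d)) _ _ _ ⟩
    (a ℚ.* (b ℚ.* φ d) ℚ.+ a ℚ.* extend φ p) ℚ.+ (b ℚ.* ψ d ℚ.+ extend ψ p)
      ≡⟨ ≡.cong (ℚ._+ _) (≡.sym (ℚ.*-distribˡ-+ a (b ℚ.* φ d) _)) ⟩
    a ℚ.* (b ℚ.* φ d ℚ.+ extend φ p) ℚ.+ (b ℚ.* ψ d ℚ.+ extend ψ p) ∎
    where
    swap : b ℚ.* (a ℚ.* φ d) ≡ a ℚ.* (b ℚ.* φ d)
    swap = ≡.trans (≡.sym (ℚ.*-assoc b a _)) (≡.trans (≡.cong (ℚ._* φ d) (ℚ.*-comm b a)) (ℚ.*-assoc a b _))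

  extend-0 : ∀ p → extend (λ _ → 0ℚ) p ≡ 0ℚ
  extend-0 []            = ≡.refl
  extend-0 ((a , _) ∷ p) = ≡.trans (≡.cong₂ ℚ._+_ (ℚ.*-zeroʳ a) (extend-0 p)) (ℚ.+-identityʳ 0ℚ)

  extend-swap : ∀ (φ : Vec ℕ k → Vec ℕ k → ℚ) p q →
    extend (λ d → extend (φ d) q) p ≡ extend (λ e → extend (λ d → φ d e) p) q
  extend-swap φ []            q = ≡.sym (extend-0 q)
  extend-swap φ ((a , d) ∷ p) q = ≡.trans (≡.cong (a ℚ.* extend (φ d) q ℚ.+_) (extend-swap φ p q))
    (≡.sym (extend-linear a (φ d) (λ e → extend (λ d → φ d e) p) q))

  private
    -- Decides whether the monomial with exponents `d` divides the one with exponents `e`, and gives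
    -- the quotient.
    ⊕-fibre : ∀ {n} (d e : Vec ℕ n) → (∃ λ f → zipWith ℕ._+_ d f ≡ e) ⊎ (∀ f → zipWith ℕ._+_ d f ≢ e)
    ⊕-fibre []      []      = inj₁ ([] , ≡.refl)
    ⊕-fibre (m ∷ d) (n ∷ e) with m ℕ.≤? n | ⊕-fibre d e
    ... | yes m≤n | inj₁ (f , eq) = inj₁ ((n ℕ.∸ m ∷ f) , ≡.cong₂ _∷_ (ℕ.m+[n∸m]≡n m≤n) eq)
    ... | no  m≰n | _             = inj₂ λ { (l ∷ _) eq → m≰n (≡.subst (m ℕ.≤_) (≡.cong Vec.head eq) (ℕ.m≤m+n m l)) }
    ... | yes _   | inj₂ ne       = inj₂ λ { (_ ∷ f) eq → ne f (≡.cong Vec.tail eq) }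

    ⊕-cancelˡ : ∀ {n} (d : Vec ℕ n) {e f} → zipWith ℕ._+_ d e ≡ zipWith ℕ._+_ d f → e ≡ f
    ⊕-cancelˡ []      {[]}    {[]}    _  = ≡.refl
    ⊕-cancelˡ (m ∷ d) {_ ∷ _} {_ ∷ _} eq =
      ≡.cong₂ _∷_ (ℕ.+-cancelˡ-≡ m _ _ (≡.cong Vec.head eq)) (⊕-cancelˡ d (≡.cong Vec.tail eq))

    -- Taking a coefficient after multiplication by a monomial amounts to taking the coefficient of
    -- the quotient monomial, or gives zero if there is none.
    δ-shift : ∀ e d → (∃ λ f → ∀ g → δ e (d ⊕ g) ≡ δ f g) ⊎ (∀ g → δ e (d ⊕ g) ≡ 0ℚ)
    δ-shift e d with ⊕-fibre d e
    ... | inj₂ ne       = inj₂ λ g → ≡.cong (if_then 1ℚ else 0ℚ) (dec-false (Vec.≡-dec ℕ._≟_ _ _) (ne g))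
    ... | inj₁ (f , ≡.refl) = inj₁ (f , shifted)
      where
      shifted : ∀ g → δ (d ⊕ f) (d ⊕ g) ≡ δ f g
      shifted g with Vec.≡-dec ℕ._≟_ g f
      ... | yes ≡.refl = ≡.cong (if_then 1ℚ else 0ℚ) (dec-true (Vec.≡-dec ℕ._≟_ (d ⊕ g) (d ⊕ g)) ≡.refl)
      ... | no g≢f     = ≡.cong (if_then 1ℚ else 0ℚ) (dec-false (Vec.≡-dec ℕ._≟_ _ _) (g≢f ∘ ⊕-cancelˡ d))

  private
    byDeltas : ∀ {p q} → (∀ e → extend (δ e) p ≡ extend (δ e) q) → p ≈ q
    byDeltas {p} {q} eq e = begin
      coeff p e          ≡⟨ coeff≡extend p e ⟩
      extend (δ e) p     ≡⟨ eq e ⟩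
      extend (δ e) q     ≡⟨ coeff≡extend q e ⟨
      coeff q e          ∎

    deltas : ∀ {p q} → p ≈ q → ∀ e → extend (δ e) p ≡ extend (δ e) q
    deltas {p} {q} eq e = ≡.trans (≡.sym (coeff≡extend p e)) (≡.trans (eq e) (coeff≡extend q e))

  -- Ring laws hold under every functional `φ`, which lets `extend-*` be iterated with the shifted
  -- functionals that it produces.
  byExtensions : ∀ {p q} → (∀ φ → extend φ p ≡ extend φ q) → p ≈ q
  byExtensions {p} {q} eq = byDeltas {p} {q} λ e → eq (δ e)

  *-comm : ∀ p q → p * q ≈ q * p
  *-comm p q = byExtensions {p * q} {q * p} λ φ → begin
    extend φ (p * q)                                 ≡⟨ extend-* φ p q ⟩
    extend (λ d → extend (λ e → φ (d ⊕ e)) q) p      ≡⟨ extend-swap (λ d e → φ (d ⊕ e)) p q ⟩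
    extend (λ e → extend (λ d → φ (d ⊕ e)) p) q
      ≡⟨ extend-cong (λ e → extend-cong (λ d → ≡.cong φ (Vec.zipWith-comm ℕ.+-comm d e)) p) q ⟩
    extend (λ e → extend (λ d → φ (e ⊕ d)) p) q      ≡⟨ extend-* φ q p ⟨
    extend φ (q * p)                                 ∎

  -- The hypothesis speaks of Kronecker deltas only, whereas `extend-*` evaluates `q` under shifted
  -- deltas; by `δ-shift` these are again deltas or zero.
  *-congˡ : ∀ p {q r} → q ≈ r → p * q ≈ p * r
  *-congˡ p {q} {r} q≈r = byDeltas {p * q} {p * r} λ e → ≡.trans (extend-* (δ e) p q)
    (≡.trans (extend-cong (λ d → shifts e d (δ-shift e d)) p) (≡.sym (extend-* (δ e) p r)))
    where
    shifts : ∀ e d → (∃ λ f → ∀ g → δ e (d ⊕ g) ≡ δ f g) ⊎ (∀ g → δ e (d ⊕ g) ≡ 0ℚ) →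
      extend (λ g → δ e (d ⊕ g)) q ≡ extend (λ g → δ e (d ⊕ g)) r
    shifts e d (inj₁ (f , eq)) =
      ≡.trans (extend-cong eq q) (≡.trans (deltas {q} {r} q≈r f) (≡.sym (extend-cong eq r)))
    shifts e d (inj₂ eq)       =
      ≡.trans (extend-cong eq q) (≡.trans (extend-0 q) (≡.sym (≡.trans (extend-cong eq r) (extend-0 r))))

  *-cong : ∀ {p p′ q q′} → p ≈ p′ → q ≈ q′ → p * q ≈ p′ * q′
  *-cong {p} {p′} {q} {q′} p≈p′ q≈q′ e = begin
    coeff (p * q) e      ≡⟨ *-congˡ p {q} {q′} q≈q′ e ⟩
    coeff (p * q′) e     ≡⟨ *-comm p q′ e ⟩
    coeff (q′ * p) e     ≡⟨ *-congˡ q′ {p} {p′} p≈p′ e ⟩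
    coeff (q′ * p′) e    ≡⟨ *-comm q′ p′ e ⟩
    coeff (p′ * q′) e    ∎

  *-assoc : ∀ p q r → (p * q) * r ≈ p * (q * r)
  *-assoc p q r = byExtensions {(p * q) * r} {p * (q * r)} λ φ → begin
    extend φ ((p * q) * r)
      ≡⟨ extend-* φ (p * q) r ⟩
    extend (λ d → extend (λ g → φ (d ⊕ g)) r) (p * q)
      ≡⟨ extend-* _ p q ⟩
    extend (λ d → extend (λ e → extend (λ g → φ ((d ⊕ e) ⊕ g)) r) q) p
      ≡⟨ extend-cong (λ d → extend-cong (λ e → extend-cong (λ g → ≡.cong φ (Vec.zipWith-assoc ℕ.+-assoc d e g)) r) q) p ⟩
    extend (λ d → extend (λ e → extend (λ g → φ (d ⊕ (e ⊕ g))) r) q) p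
      ≡⟨ extend-cong (λ d → extend-* (λ e → φ (d ⊕ e)) q r) p ⟨
    extend (λ d → extend (λ e → φ (d ⊕ e)) (q * r)) p
      ≡⟨ extend-* φ p (q * r) ⟨
    extend φ (p * (q * r)) ∎

  *-identityˡ : ∀ p → 1# * p ≈ p
  *-identityˡ p = byExtensions {1# * p} {p} λ φ → begin
    extend φ (1# * p)                             ≡⟨ extend-* φ 1# p ⟩
    1ℚ ℚ.* extend (λ e → φ (0ᵉ ⊕ e)) p ℚ.+ 0ℚ     ≡⟨ ℚ.+-identityʳ _ ⟩
    1ℚ ℚ.* extend (λ e → φ (0ᵉ ⊕ e)) p            ≡⟨ ℚ.*-identityˡ _ ⟩
    extend (λ e → φ (0ᵉ ⊕ e)) p
      ≡⟨ extend-cong (λ e → ≡.cong φ (Vec.zipWith-identityˡ ℕ.+-identityˡ e)) p ⟩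
    extend φ p                                    ∎

  *-distribʳ : ∀ r p q → (p + q) * r ≈ p * r + q * r
  *-distribʳ r p q = byExtensions {(p + q) * r} {p * r + q * r} λ φ → begin
    extend φ ((p + q) * r)                     ≡⟨ extend-* φ (p + q) r ⟩
    extend _ (p + q)                           ≡⟨ extend-+ _ p q ⟩
    extend _ p ℚ.+ extend _ q                  ≡⟨ ≡.cong₂ ℚ._+_ (extend-* φ p r) (extend-* φ q r) ⟨
    extend φ (p * r) ℚ.+ extend φ (q * r)      ≡⟨ extend-+ φ (p * r) (q * r) ⟨
    extend φ (p * r + q * r)                   ∎

  coeff-+ : ∀ p q e → coeff (p + q) e ≡ coeff p e ℚ.+ coeff q e
  coeff-+ p q e = ≡.trans (coeff≡extend (p + q) e) (≡.trans (extend-+ (δ e) p q)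
    (≡.sym (≡.cong₂ ℚ._+_ (coeff≡extend p e) (coeff≡extend q e))))

  coeff-neg : ∀ p e → coeff (- p) e ≡ ℚ.- coeff p e
  coeff-neg p e = ≡.trans (coeff≡extend (- p) e) (≡.trans (extend-neg (δ e) p)
    (≡.cong ℚ.-_ (≡.sym (coeff≡extend p e))))

  +-cong : ∀ {p p′ q q′} → p ≈ p′ → q ≈ q′ → p + q ≈ p′ + q′
  +-cong {p} {p′} {q} {q′} p≈p′ q≈q′ e =
    ≡.trans (coeff-+ p q e) (≡.trans (≡.cong₂ ℚ._+_ (p≈p′ e) (q≈q′ e)) (≡.sym (coeff-+ p′ q′ e)))

  +-comm : ∀ p q → p + q ≈ q + p
  +-comm p q e = ≡.trans (coeff-+ p q e) (≡.trans (ℚ.+-comm (coeff p e) (coeff q e)) (≡.sym (coeff-+ q p e)))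

  -‿inverseʳ : ∀ p → p + - p ≈ 0#
  -‿inverseʳ p e = ≡.trans (coeff-+ p (- p) e)
    (≡.trans (≡.cong (coeff p e ℚ.+_) (coeff-neg p e)) (ℚ.+-inverseʳ (coeff p e)))

  polyCommutativeRing : CommutativeRing 0ℓ 0ℓ
  polyCommutativeRing = record
    { RawRing (polyRing k)
    ; isCommutativeRing = record
      { isRing = record
        { +-isAbelianGroup = record
          { isGroup = record
            { isMonoid = record
              { isSemigroup = record
                { isMagma = record
                  { isEquivalence = record
                    { refl  = λ _ → ≡.refl
                    ; sym   = λ p≈q e → ≡.sym (p≈q e)
                    ; trans = λ p≈q q≈r e → ≡.trans (p≈q e) (q≈r e)
                    }
                  ; ∙-cong = λ {p} {p′} {q} {q′} → +-cong {p} {p′} {q} {q′}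
                  }
                ; assoc = λ p q r e → ≡.cong (λ s → coeff s e) (List.++-assoc p q r)
                }
              ; identity = (λ p e → ≡.refl) , (λ p e → ≡.cong (λ s → coeff s e) (List.++-identityʳ p))
              }
            ; inverse = (λ p e → ≡.trans (+-comm (- p) p e) (-‿inverseʳ p e)) , -‿inverseʳ
            ; ⁻¹-cong = λ {p} {q} p≈q e →
                ≡.trans (coeff-neg p e) (≡.trans (≡.cong ℚ.-_ (p≈q e)) (≡.sym (coeff-neg q e)))
            }
          ; comm = +-comm
          }
        ; *-cong = λ {p} {p′} {q} {q′} → *-cong {p} {p′} {q} {q′}
        ; *-assoc = *-assoc
        ; *-identity = *-identityˡ , λ p e → ≡.trans (*-comm p 1# e) (*-identityˡ p e)
        ; distrib = (λ r p q e → ≡.trans (*-comm r (p + q) e) (≡.trans (*-distribʳ r p q e)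
                      (+-cong {p * r} {r * p} {q * r} {r * q} (*-comm p r) (*-comm q r) e)))
                  , *-distribʳ
        }
      ; *-comm = *-comm
      }
    }

  p+p≈0⇒p≈0 : ∀ p → p + p ≈ 0# → p ≈ 0#
  p+p≈0⇒p≈0 p p+p≈0 e = begin
    coeff p e                                    ≡⟨ ℚ.*-identityˡ _ ⟨
    (ℚ.½ ℚ.+ ℚ.½) ℚ.* coeff p e                  ≡⟨ ℚ.*-distribʳ-+ (coeff p e) ℚ.½ ℚ.½ ⟩
    ℚ.½ ℚ.* coeff p e ℚ.+ ℚ.½ ℚ.* coeff p e      ≡⟨ ℚ.*-distribˡ-+ ℚ.½ (coeff p e) (coeff p e) ⟨
    ℚ.½ ℚ.* (coeff p e ℚ.+ coeff p e)            ≡⟨ ≡.cong (ℚ.½ ℚ.*_) (≡.trans (≡.sym (coeff-+ p p e)) (p+p≈0 e)) ⟩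
    ℚ.½ ℚ.* 0ℚ                                   ≡⟨ ℚ.*-zeroʳ ℚ.½ ⟩
    0ℚ                                           ∎

-- Binary trees and their generating functions

data Tree : Set where
  leaf : Tree
  node : (l r : Tree) → Tree

size : Tree → ℕ
size leaf       = 0
size (node l r) = suc (size l ℕ.+ size r)

module _ {a b c} {A : Set a} {B : Set b} {C : Set c} (f : A → B → C) where

  -- The clauses follow the computation of the Cauchy product, so summing over the list gives the
  -- product of series without any reindexing.
  convolve : (ℕ → List A) → (ℕ → List B) → ℕ → List C
  convolve F G zero    = cartesianProductWith f (F 0) (G 0)
  convolve F G (suc n) = cartesianProductWith f (F 0) (G (suc n)) ++ convolve (F ∘ suc) G n

  convolve-cong : ∀ {F F′ G G′} n → (∀ {i} → i ≤ n → F i ≡ F′ i) → (∀ {i} → i ≤ n → G i ≡ G′ i) →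
    convolve F G n ≡ convolve F′ G′ n
  convolve-cong zero    F≡ G≡ = ≡.cong₂ (cartesianProductWith f) (F≡ z≤n) (G≡ z≤n)
  convolve-cong (suc n) F≡ G≡ = ≡.cong₂ _++_ (≡.cong₂ (cartesianProductWith f) (F≡ z≤n) (G≡ ℕ.≤-refl))
    (convolve-cong n (F≡ ∘ s≤s) (G≡ ∘ ℕ.m≤n⇒m≤1+n))

-- The first argument bounds the height and only serves the termination checker.
forest : ℕ → ℕ → List Tree
forest zero    _       = []
forest (suc h) zero    = leaf ∷ []
forest (suc h) (suc n) = convolve node (forest h) (forest h) n

trees : ℕ → List Tree
trees n = forest (suc n) n

forest-stable : ∀ h h′ {n} → n < h → n < h′ → forest h n ≡ forest h′ n
forest-stable (suc h) (suc h′) {zero}  _   _    = ≡.refl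
forest-stable (suc h) (suc h′) {suc n} n<h n<h′ = convolve-cong node n stable stable
  where
  stable : ∀ {i} → i ≤ n → forest h i ≡ forest h′ i
  stable i≤n = forest-stable h h′ (ℕ.≤-<-trans i≤n (s<s⁻¹ n<h)) (ℕ.≤-<-trans i≤n (s<s⁻¹ n<h′))

trees-suc : ∀ n → trees (suc n) ≡ convolve node trees trees n
trees-suc n = convolve-cong node n stable stable
  where
  stable : ∀ {i} → i ≤ n → forest (suc n) i ≡ trees i
  stable i≤n = forest-stable (suc n) _ (s≤s i≤n) ℕ.≤-refl

-- The letters next to the block of a permutation that a subtree describes: a letter exceeding the whole
-- block may stand on its left, on its right, or on both sides.
data Context : Set where
  bare right left left<right left>right : Context

-- In L m R the block L keeps its left neighbour and has m on its right; R has m on its left and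
-- keeps its right neighbour. A framing letter exceeds m, so a framed L is always of kind
-- `left>right` and a framed R of kind `left<right`.
contextˡ contextʳ : Context → Context
contextˡ bare       = right
contextˡ right      = right
contextˡ left       = left>right
contextˡ left<right = left>right
contextˡ left>right = left>right
contextʳ bare       = left
contextʳ right      = left<right
contextʳ left       = left
contextʳ left<right = left<right
contextʳ left>right = left<right

module _ {c ℓ} (R : CommutativeRing c ℓ) where
  open CommutativeRing R
  open IntegerSolver R

  -- The summands are the four shapes of a root: no subtree, only a left one, only a right one,
  -- both. Here `e` is the series of the empty tree and `t` marks the root.
  assemble : ∀ a₁ a₂ a₃ a₄ t L R {e p₁ p₂ p₃ p₄} → e ≈ 1# →
    p₁ ≈ t * (e * e) → p₂ ≈ t * (L * e) → p₃ ≈ t * (e * R) → p₄ ≈ t * (L * R) →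
    a₁ * p₁ + a₂ * p₂ + a₃ * p₃ + a₄ * p₄ ≈ t * (a₁ + a₂ * L + a₃ * R + a₄ * (L * R))
  assemble a₁ a₂ a₃ a₄ t L R e≈1 p₁≈ p₂≈ p₃≈ p₄≈ = trans
    (+-cong (+-cong (+-cong
      (*-congˡ (trans p₁≈ (*-congˡ (*-cong e≈1 e≈1))))
      (*-congˡ (trans p₂≈ (*-congˡ (*-congˡ e≈1)))))
      (*-congˡ (trans p₃≈ (*-congˡ (*-congʳ e≈1)))))
      (*-congˡ p₄≈))
    (solve 7 (λ a₁ a₂ a₃ a₄ t L R →
      a₁ :* (t :* (con 1ℤ :* con 1ℤ)) :+ a₂ :* (t :* (L :* con 1ℤ)) :+ a₃ :* (t :* (con 1ℤ :* R)) :+ a₄ :* (t :* (L :* R))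
      := t :* (a₁ :+ a₂ :* L :+ a₃ :* R :+ a₄ :* (L :* R))) refl a₁ a₂ a₃ a₄ t L R)

module TreeSeries {c ℓ} (R : CommutativeRing c ℓ) (y x₁ x₂ x₃ x₄ : CommutativeRing.Carrier R) where
  open CommutativeRing R
  open Series R
  open SetoidReasoning setoid
  private
    module S = CommutativeRing seriesCommutativeRing
    interchange = CommutativeSemigroupProperties.interchange
      (record { isCommutativeSemigroup = +-isCommutativeSemigroup })

    K = constant rawRing
    t = indeterminate rawRing

  module _ {a} {A : Set a} where
    ∑ : (A → Carrier) → List A → Carrier
    ∑ p xs = foldr _+_ 0# (map p xs)

    ∑-cong : ∀ {p q} → (∀ x → p x ≈ q x) → ∀ xs → ∑ p xs ≈ ∑ q xs
    ∑-cong p≈q []       = refl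
    ∑-cong p≈q (x ∷ xs) = +-cong (p≈q x) (∑-cong p≈q xs)

    ∑-++ : ∀ p xs ys → ∑ p (xs ++ ys) ≈ ∑ p xs + ∑ p ys
    ∑-++ p []       ys = sym (+-identityˡ _)
    ∑-++ p (x ∷ xs) ys = trans (+-congˡ (∑-++ p xs ys)) (sym (+-assoc _ _ _))

    ∑-+ : ∀ p q xs → ∑ (λ x → p x + q x) xs ≈ ∑ p xs + ∑ q xs
    ∑-+ p q []       = sym (+-identityˡ 0#)
    ∑-+ p q (x ∷ xs) = trans (+-congˡ (∑-+ p q xs)) (interchange _ _ _ _)

    ∑-* : ∀ u p xs → ∑ (λ x → u * p x) xs ≈ u * ∑ p xs
    ∑-* u p []       = sym (zeroʳ u)
    ∑-* u p (x ∷ xs) = trans (+-congˡ (∑-* u p xs)) (sym (distribˡ _ _ _))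

  module _ {a b d} {A : Set a} {B : Set b} {C : Set d} (f : A → B → C)
    {p : A → Carrier} {q : B → Carrier} {r : C → Carrier} (r≈pq : ∀ x z → r (f x z) ≈ p x * q z) where

    ∑-cartesianProductWith : ∀ xs zs → ∑ r (cartesianProductWith f xs zs) ≈ ∑ p xs * ∑ q zs
    ∑-cartesianProductWith []       zs = sym (zeroˡ _)
    ∑-cartesianProductWith (x ∷ xs) zs = begin
      ∑ r (map (f x) zs ++ cartesianProductWith f xs zs)    ≈⟨ ∑-++ r (map (f x) zs) _ ⟩
      ∑ r (map (f x) zs) + ∑ r (cartesianProductWith f xs zs)
        ≈⟨ +-cong (row zs) (∑-cartesianProductWith xs zs) ⟩
      p x * ∑ q zs + ∑ p xs * ∑ q zs                        ≈⟨ distribʳ _ _ _ ⟨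
      (p x + ∑ p xs) * ∑ q zs                               ∎
      where
      row : ∀ zs → ∑ r (map (f x) zs) ≈ p x * ∑ q zs
      row []       = sym (zeroʳ _)
      row (z ∷ zs) = trans (+-cong (r≈pq x z) (row zs)) (sym (distribˡ _ _ _))

    ∑-convolve : ∀ F G n → ∑ r (convolve f F G n) ≈ ((∑ p ∘ F) *ₛ (∑ q ∘ G)) n
    ∑-convolve F G zero    = trans (∑-cartesianProductWith (F 0) (G 0)) (sym (+-identityʳ _))
    ∑-convolve F G (suc n) = trans (∑-++ r (cartesianProductWith f (F 0) (G (suc n))) _)
      (+-cong (∑-cartesianProductWith (F 0) (G (suc n))) (∑-convolve (F ∘ suc) G n))

  gf : (Tree → Carrier) → ℕ → Carrier
  gf p n = ∑ p (trees n)

  infixr 7 _⊛_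
  _⊛_ : (p q : Tree → Carrier) → Tree → Carrier
  (p ⊛ q) leaf       = 0#
  (p ⊛ q) (node l r) = p l * q r

  -- The root itself contributes one letter, hence the factor `t`.
  gf-⊛ : ∀ p q → gf (p ⊛ q) ≈ₛ t *ₛ (gf p *ₛ gf q)
  gf-⊛ p q zero    = trans (+-identityʳ 0#) (sym (shift-zero (gf p *ₛ gf q)))
  gf-⊛ p q (suc n) = begin
    ∑ (p ⊛ q) (trees (suc n))                    ≡⟨ ≡.cong (∑ (p ⊛ q)) (trees-suc n) ⟩
    ∑ (p ⊛ q) (convolve node trees trees n)      ≈⟨ ∑-convolve node (λ _ _ → refl) trees trees n ⟩
    (gf p *ₛ gf q) n                             ≈⟨ shift-suc (gf p *ₛ gf q) n ⟨
    (t *ₛ (gf p *ₛ gf q)) (suc n)                ∎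

  isLeaf : Tree → Carrier
  isLeaf leaf       = 1#
  isLeaf (node _ _) = 0#

  gf-isLeaf : gf isLeaf ≈ₛ 1ₛ
  gf-isLeaf zero    = +-identityʳ 1#
  gf-isLeaf (suc n) = begin
    ∑ isLeaf (trees (suc n))                     ≡⟨ ≡.cong (∑ isLeaf) (trees-suc n) ⟩
    ∑ isLeaf (convolve node trees trees n)
      ≈⟨ ∑-convolve node {λ _ → 0#} {λ _ → 0#} (λ _ _ → sym (zeroˡ 0#)) trees trees n ⟩
    ((∑ (λ _ → 0#) ∘ trees) *ₛ (∑ (λ _ → 0#) ∘ trees)) n
      ≈⟨ *ₛ-cong {g = ∑ (λ _ → 0#) ∘ trees} (λ i → ∑-0 (trees i)) (λ _ → refl) n ⟩
    (0ₛ *ₛ (∑ (λ _ → 0#) ∘ trees)) n             ≈⟨ *ₛ-zeroˡ (∑ (λ _ → 0#) ∘ trees) n ⟩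
    0#                                           ∎
    where
    ∑-0 : ∀ ts → ∑ {A = Tree} (λ _ → 0#) ts ≈ 0#
    ∑-0 []       = refl
    ∑-0 (_ ∷ ts) = trans (+-identityˡ _) (∑-0 ts)

  -- The contribution of a new maximum according to which of the two blocks beside it are empty.
  root rootˡ rootʳ : Context → Carrier
  root bare        = 1#
  root right       = 1#
  root left        = y
  root left<right  = y * x₂
  root left>right  = y
  rootˡ bare       = 1#
  rootˡ right      = x₁
  rootˡ left       = 1#
  rootˡ left<right = x₁
  rootˡ left>right = x₁
  rootʳ bare       = 1#
  rootʳ right      = 1#
  rootʳ left       = y * x₄
  rootʳ left<right = y * x₄
  rootʳ left>right = y * x₄

  -- An empty block changes the windows around it and is treated apart through `isLeaf`, so leaves
  -- weigh zero here and exactly one of the four summands can survive at each node.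
  treeWeight : Context → Tree → Carrier
  treeWeight c leaf       = 0#
  treeWeight c (node l r) =
      root c * (isLeaf l * isLeaf r)
    + rootˡ c * (treeWeight (contextˡ c) l * isLeaf r)
    + rootʳ c * (isLeaf l * treeWeight (contextʳ c) r)
    + x₃ * (treeWeight (contextˡ c) l * treeWeight (contextʳ c) r)

  module _ (p : Tree → Carrier) {p₁ p₂ p₃ p₄ : Tree → Carrier} where
    gf-∑₄ : ∀ a₁ a₂ a₃ a₄ → (∀ t → p t ≈ a₁ * p₁ t + a₂ * p₂ t + a₃ * p₃ t + a₄ * p₄ t) → gf p ≈ₛ
      K a₁ *ₛ gf p₁ +ₛ K a₂ *ₛ gf p₂ +ₛ K a₃ *ₛ gf p₃ +ₛ K a₄ *ₛ gf p₄
    gf-∑₄ a₁ a₂ a₃ a₄ eq n = trans (∑-cong eq (trees n))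
      (trans (∑-+ _ _ (trees n)) (+-cong
        (trans (∑-+ _ _ (trees n)) (+-cong
          (trans (∑-+ _ _ (trees n)) (+-cong (scaled a₁ p₁) (scaled a₂ p₂)))
          (scaled a₃ p₃)))
        (scaled a₄ p₄)))
      where
      scaled : ∀ a q → ∑ (λ t → a * q t) (trees n) ≈ (K a *ₛ gf q) n
      scaled a q = trans (∑-* a q (trees n)) (sym (constant-* a (gf q) n))

  gf-treeWeight : ∀ c (let L = gf (treeWeight (contextˡ c)) ; R = gf (treeWeight (contextʳ c))) →
    gf (treeWeight c) ≈ₛ t *ₛ (K (root c) +ₛ K (rootˡ c) *ₛ L +ₛ K (rootʳ c) *ₛ R +ₛ K x₃ *ₛ (L *ₛ R))
  gf-treeWeight c = S.trans
    (gf-∑₄ (treeWeight c) (root c) (rootˡ c) (rootʳ c) x₃ λ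
      { leaf → solve 4 (λ a b c d → con 0ℤ := a :* con 0ℤ :+ b :* con 0ℤ :+ c :* con 0ℤ :+ d :* con 0ℤ) refl _ _ _ _
      ; (node l r) → refl })
    (assemble seriesCommutativeRing (K (root c)) (K (rootˡ c)) (K (rootʳ c)) (K x₃) t (gf w₁) (gf w₂)
      gf-isLeaf (gf-⊛ isLeaf isLeaf) (gf-⊛ w₁ isLeaf) (gf-⊛ isLeaf w₂) (gf-⊛ w₁ w₂))
    where
    open IntegerSolver R
    w₁ = treeWeight (contextˡ c)
    w₂ = treeWeight (contextʳ c)

-- Descents and consecutive patterns of words

bit : Bool → ℕ
bit b = if b then 1 else 0

data Order (a b c : ℕ) : Word → Set where
  123-order : a < b → b < c → Order a b c (1 ∷ 2 ∷ 3 ∷ [])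
  132-order : a < c → c < b → Order a b c (1 ∷ 3 ∷ 2 ∷ [])
  213-order : b < a → a < c → Order a b c (2 ∷ 1 ∷ 3 ∷ [])
  231-order : c < a → a < b → Order a b c (2 ∷ 3 ∷ 1 ∷ [])
  312-order : b < c → c < a → Order a b c (3 ∷ 1 ∷ 2 ∷ [])
  321-order : c < b → b < a → Order a b c (3 ∷ 2 ∷ 1 ∷ [])

private
  <ᵇ-true : ∀ {m n} → m < n → (m <ᵇ n) ≡ true
  <ᵇ-true {m} {n} m<n = dec-true (m ℕ.<? n) m<n

  <ᵇ-false : ∀ {m n} → m < n → (n <ᵇ m) ≡ false
  <ᵇ-false {m} {n} m<n = dec-false (n ℕ.<? m) (ℕ.<-asym m<n)

  <ᵇ-irrefl : ∀ n → (n <ᵇ n) ≡ false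
  <ᵇ-irrefl n = dec-false (n ℕ.<? n) (ℕ.<-irrefl ≡.refl)

length-filter-∷ : ∀ {a p} {A : Set a} {P : A → Set p} (P? : ∀ x → Dec (P x)) x xs →
  length (filter P? (x ∷ xs)) ≡ bit (does (P? x)) ℕ.+ length (filter P? xs)
length-filter-∷ P? x xs with does (P? x)
... | true  = ≡.refl
... | false = ≡.refl

-- With the ranks expressed by Booleans, rewriting the nine comparisons makes the reduction compute.
red-triple : ∀ a b c → let rank = λ x → suc (bit (a <ᵇ x) ℕ.+ (bit (b <ᵇ x) ℕ.+ (bit (c <ᵇ x) ℕ.+ 0))) in
  red (a ∷ b ∷ c ∷ []) ≡ rank a ∷ rank b ∷ rank c ∷ []
red-triple a b c = ≡.cong₂ _∷_ (rank a) (≡.cong₂ _∷_ (rank b) (≡.cong₂ _∷_ (rank c) ≡.refl))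
  where
  rank : ∀ x → suc (length (filter (ℕ._<? x) (a ∷ b ∷ c ∷ []))) ≡
    suc (bit (a <ᵇ x) ℕ.+ (bit (b <ᵇ x) ℕ.+ (bit (c <ᵇ x) ℕ.+ 0)))
  rank x = ≡.cong suc (≡.trans (length-filter-∷ (ℕ._<? x) a _) (≡.cong (bit (a <ᵇ x) ℕ.+_)
    (≡.trans (length-filter-∷ (ℕ._<? x) b _) (≡.cong (bit (b <ᵇ x) ℕ.+_) (length-filter-∷ (ℕ._<? x) c [])))))

red-order : ∀ {a b c γ} → Order a b c γ → red (a ∷ b ∷ c ∷ []) ≡ γ
red-order {a} {b} {c} (123-order p q)
  rewrite red-triple a b c | <ᵇ-irrefl a | <ᵇ-irrefl b | <ᵇ-irrefl c | <ᵇ-true p | <ᵇ-true q | <ᵇ-true (ℕ.<-trans p q)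
    | <ᵇ-false p | <ᵇ-false q | <ᵇ-false (ℕ.<-trans p q) = ≡.refl
red-order {a} {b} {c} (132-order p q)
  rewrite red-triple a b c | <ᵇ-irrefl a | <ᵇ-irrefl b | <ᵇ-irrefl c | <ᵇ-true p | <ᵇ-true q | <ᵇ-true (ℕ.<-trans p q)
    | <ᵇ-false p | <ᵇ-false q | <ᵇ-false (ℕ.<-trans p q) = ≡.refl
red-order {a} {b} {c} (213-order p q)
  rewrite red-triple a b c | <ᵇ-irrefl a | <ᵇ-irrefl b | <ᵇ-irrefl c | <ᵇ-true p | <ᵇ-true q | <ᵇ-true (ℕ.<-trans p q)
    | <ᵇ-false p | <ᵇ-false q | <ᵇ-false (ℕ.<-trans p q) = ≡.refl
red-order {a} {b} {c} (231-order p q)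
  rewrite red-triple a b c | <ᵇ-irrefl a | <ᵇ-irrefl b | <ᵇ-irrefl c | <ᵇ-true p | <ᵇ-true q | <ᵇ-true (ℕ.<-trans p q)
    | <ᵇ-false p | <ᵇ-false q | <ᵇ-false (ℕ.<-trans p q) = ≡.refl
red-order {a} {b} {c} (312-order p q)
  rewrite red-triple a b c | <ᵇ-irrefl a | <ᵇ-irrefl b | <ᵇ-irrefl c | <ᵇ-true p | <ᵇ-true q | <ᵇ-true (ℕ.<-trans p q)
    | <ᵇ-false p | <ᵇ-false q | <ᵇ-false (ℕ.<-trans p q) = ≡.refl
red-order {a} {b} {c} (321-order p q)
  rewrite red-triple a b c | <ᵇ-irrefl a | <ᵇ-irrefl b | <ᵇ-irrefl c | <ᵇ-true p | <ᵇ-true q | <ᵇ-true (ℕ.<-trans p q)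
    | <ᵇ-false p | <ᵇ-false q | <ᵇ-false (ℕ.<-trans p q) = ≡.refl

occurs : Word → Word → ℕ
occurs γ w = bit (does (List.≡-dec ℕ._≟_ w γ))

module _ (γ₁ γ₂ γ₃ : ℕ) where
  private
    γ : Word
    γ = γ₁ ∷ γ₂ ∷ γ₃ ∷ []

  occurs-length : ∀ w → length w ≢ 3 → occurs γ (red w) ≡ 0
  occurs-length w ≢3 = ≡.cong bit (dec-false (List.≡-dec ℕ._≟_ (red w) γ)
    λ eq → ≢3 (≡.trans (≡.sym (List.length-map _ w)) (≡.cong length eq)))

  mch-∷ : ∀ a w → (γ -mch) (a ∷ w) ≡ occurs γ (red (take 3 (a ∷ w))) ℕ.+ (γ -mch) w
  mch-∷ a w = length-filter-∷ (λ w → List.≡-dec ℕ._≟_ (red (take 3 w)) γ) (a ∷ w) (tails w)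

  mch-[] : (γ -mch) [] ≡ 0
  mch-[] = ≡.refl

  mch-singleton : ∀ a → (γ -mch) (a ∷ []) ≡ 0
  mch-singleton a = ≡.trans (mch-∷ a []) (≡.cong₂ ℕ._+_ (occurs-length (a ∷ []) λ ()) mch-[])

  mch-pair : ∀ a b → (γ -mch) (a ∷ b ∷ []) ≡ 0
  mch-pair a b = ≡.trans (mch-∷ a (b ∷ [])) (≡.cong₂ ℕ._+_ (occurs-length (a ∷ b ∷ []) λ ()) (mch-singleton b))

  private
    extend : ∀ {o s s₁ r t t₁} → t ≡ o ℕ.+ s → t₁ ≡ o ℕ.+ s₁ → s ≡ s₁ ℕ.+ r → t ≡ t₁ ℕ.+ r
    extend {o} {s₁ = s₁} {r} ≡.refl ≡.refl ≡.refl = ≡.sym (ℕ.+-assoc o s₁ r)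

  -- A window of three letters ends at `m` or earlier, is centred at `m`, or starts at `m` or later;
  -- the overlap of the two words in the single letter `m` creates no further window.
  mch-split : ∀ U u m v V → (γ -mch) (U ++ u ∷ m ∷ v ∷ V) ≡
    (γ -mch) (U ++ u ∷ m ∷ []) ℕ.+ (occurs γ (red (u ∷ m ∷ v ∷ [])) ℕ.+ (γ -mch) (m ∷ v ∷ V))
  mch-split []              u m v V = ≡.trans (mch-∷ u (m ∷ v ∷ V))
    (≡.cong (ℕ._+ (occurs γ (red (u ∷ m ∷ v ∷ [])) ℕ.+ (γ -mch) (m ∷ v ∷ V))) (≡.sym (mch-pair u m)))
  -- The letters of `U` are exposed up to three deep so that `take 3` computes to the same window on
  -- both sides.
  mch-split (a ∷ [])        u m v V = extend (mch-∷ a (u ∷ m ∷ v ∷ V)) (mch-∷ a (u ∷ m ∷ [])) (mch-split [] u m v V)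
  mch-split (a ∷ b ∷ [])    u m v V =
    extend (mch-∷ a (b ∷ u ∷ m ∷ v ∷ V)) (mch-∷ a (b ∷ u ∷ m ∷ [])) (mch-split (b ∷ []) u m v V)
  mch-split (a ∷ b ∷ c ∷ U) u m v V =
    extend (mch-∷ a (b ∷ c ∷ U ++ u ∷ m ∷ v ∷ V)) (mch-∷ a (b ∷ c ∷ U ++ u ∷ m ∷ [])) (mch-split (b ∷ c ∷ U) u m v V)

des-∷∷ : ∀ a b w → des (a ∷ b ∷ w) ≡ bit (b <ᵇ a) ℕ.+ des (b ∷ w)
des-∷∷ a b w with b <ᵇ a
... | true  = ≡.refl
... | false = ≡.refl

des-split : ∀ U m V → des (U ++ m ∷ V) ≡ des (U ++ m ∷ []) ℕ.+ des (m ∷ V)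
des-split []          m V = ≡.refl
des-split (a ∷ [])    m V = ≡.trans (des-∷∷ a m V)
  (≡.cong (ℕ._+ des (m ∷ V)) (≡.sym (≡.trans (des-∷∷ a m []) (ℕ.+-identityʳ _))))
des-split (a ∷ b ∷ U) m V = ≡.trans (des-∷∷ a b (U ++ m ∷ V)) (≡.trans (≡.cong (bit (b <ᵇ a) ℕ.+_) (des-split (b ∷ U) m V))
  (≡.trans (≡.sym (ℕ.+-assoc (bit (b <ᵇ a)) _ _)) (≡.cong (ℕ._+ des (m ∷ V)) (≡.sym (des-∷∷ a b (U ++ m ∷ []))))))

des-ascent : ∀ {a b} → a < b → des (a ∷ b ∷ []) ≡ 0
des-ascent {a} {b} a<b = ≡.trans (des-∷∷ a b []) (≡.cong (λ c → bit c ℕ.+ 0) (<ᵇ-false a<b))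

des-descent : ∀ {a b} → b < a → des (a ∷ b ∷ []) ≡ 1
des-descent {a} {b} b<a = ≡.trans (des-∷∷ a b []) (≡.cong (λ c → bit c ℕ.+ 0) (<ᵇ-true b<a))

-- The letters of word o t are o + 1, …, o + size t; those left of the maximum exceed those right of it.
-- The words of trees

word : ℕ → Tree → Word
word o leaf       = []
word o (node l r) = word (o ℕ.+ size r) l ++ suc (o ℕ.+ size r ℕ.+ size l) ∷ word o r

-- `word` writes the maximum as the successor of the top of the left block, the form in which
-- `frameˡ` applies by computation; bounds on the whole block use the other form.
maximum≡ : ∀ o l r → suc (o ℕ.+ size r ℕ.+ size l) ≡ o ℕ.+ size (node l r)
maximum≡ o l r = ≡.trans (≡.cong suc (≡.trans (ℕ.+-assoc o _ _) (≡.cong (o ℕ.+_) (ℕ.+-comm (size r) (size l)))))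
  (≡.sym (ℕ.+-suc o _))

_∈⟨_,_] : ℕ → ℕ → ℕ → Set
a ∈⟨ m , n ] = m < a × a ≤ n

word-range : ∀ o t → All (_∈⟨ o , o ℕ.+ size t ]) (word o t)
word-range o leaf       = []
word-range o (node l r) = All.++⁺
  (All.map (λ (lo , hi) → ℕ.≤-<-trans (ℕ.m≤m+n o (size r)) lo , ℕ.≤-trans (ℕ.m≤n⇒m≤1+n hi) max≤) (word-range (o ℕ.+ size r) l))
  ((s≤s (ℕ.≤-trans (ℕ.m≤m+n o (size r)) (ℕ.m≤m+n _ (size l))) , max≤) ∷
   All.map (λ (lo , hi) → lo , ℕ.≤-trans (ℕ.≤-trans hi (ℕ.m≤n⇒m≤1+n (ℕ.m≤m+n _ (size l)))) max≤) (word-range o r))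
  where
  max≤ = ℕ.≤-reflexive (maximum≡ o l r)

length-word : ∀ o t → length (word o t) ≡ size t
length-word o leaf       = ≡.refl
length-word o (node l r) = ≡.trans (List.length-++ (word (o ℕ.+ size r) l))
  (≡.trans (≡.cong₂ (λ m n → m ℕ.+ suc n) (length-word _ l) (length-word o r)) (ℕ.+-suc (size l) (size r)))

module _ {p} {P : ℕ → Set p} where
  uncons : ∀ {w} → w ≢ [] → All P w → ∃₂ λ a u → w ≡ a ∷ u × P a
  uncons w≢[] []       = contradiction ≡.refl w≢[]
  uncons w≢[] (pa ∷ _) = _ , _ , ≡.refl , pa

  unsnoc : ∀ {w} → w ≢ [] → All P w → ∃₂ λ u a → w ≡ u ++ a ∷ [] × P a
  unsnoc w≢[] []             = contradiction ≡.refl w≢[]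
  unsnoc w≢[] (pa ∷ [])      = [] , _ , ≡.refl , pa
  unsnoc {a ∷ _} w≢[] (pa ∷ pb ∷ ps) with u , b , eq , pc ← unsnoc (λ ()) (pb ∷ ps) = a ∷ u , b , ≡.cong (a ∷_) eq , pc

word-node≢[] : ∀ o l r → word o (node l r) ≢ []
word-node≢[] o l r eq with () ← ≡.trans (≡.sym (length-word o (node l r))) (≡.cong length eq)

-- `X` and `Z` are the neighbours of a block whose letters are at most the given number. They need
-- only exceed it: between a right block and the maximum beside it lie all values of the left block.
data Frame : Context → Word → Word → ℕ → Set where
  bare       : ∀ {n} → Frame bare [] [] n
  right      : ∀ {n z} → n < z → Frame right [] (z ∷ []) n
  left       : ∀ {n x} → n < x → Frame left (x ∷ []) [] n
  left<right : ∀ {n x z} → n < x → x < z → Frame left<right (x ∷ []) (z ∷ []) n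
  left>right : ∀ {n x z} → n < z → z < x → Frame left>right (x ∷ []) (z ∷ []) n

frameˡ : ∀ {c X Z n} → Frame c X Z (suc n) → Frame (contextˡ c) X (suc n ∷ []) n
frameˡ bare             = right ℕ.≤-refl
frameˡ (right _)        = right ℕ.≤-refl
frameˡ (left p)         = left>right ℕ.≤-refl p
frameˡ (left<right p _) = left>right ℕ.≤-refl p
frameˡ (left>right p q) = left>right ℕ.≤-refl (ℕ.<-trans p q)

frameʳ : ∀ {c X Z m n} → n < m → Frame c X Z m → Frame (contextʳ c) (m ∷ []) Z n
frameʳ n<m bare             = left n<m
frameʳ n<m (right p)        = left<right n<m p
frameʳ n<m (left _)         = left n<m
frameʳ n<m (left<right p q) = left<right n<m (ℕ.<-trans p q)
frameʳ n<m (left>right p _) = left<right n<m p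

-- Weights of words between framing letters

module Statistics {c ℓ} (Q : RawRing c ℓ) (y x₁ x₂ x₃ x₄ : RawRing.Carrier Q) where
  open RawRing Q
  open RawSemiringDefs rawSemiring using (_^_)

  -- Taking the exponents as arguments covers both whole words and single windows, and makes
  -- products an addition of exponents.
  monomial : ℕ → (Word → ℕ) → Carrier
  monomial d f = y ^ d * x₁ ^ f (1 ∷ 2 ∷ 3 ∷ []) * x₂ ^ f (2 ∷ 1 ∷ 3 ∷ [])
    * x₃ ^ f (2 ∷ 3 ∷ 1 ∷ []) * x₄ ^ f (3 ∷ 2 ∷ 1 ∷ [])

  weight : Word → Carrier
  weight σ = monomial (des σ) (λ γ → (γ -mch) σ)

  avoidersSeries : ℕ → Carrier
  avoidersSeries n = foldr _+_ 0# (map weight (𝒮⟨ 1 ∷ 3 ∷ 2 ∷ [] ⟩ n))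

module WordWeights {c ℓ} (R : CommutativeRing c ℓ) (y x₁ x₂ x₃ x₄ : CommutativeRing.Carrier R) where
  open CommutativeRing R
  open Exp semiring using (_^_; ^-homo-*)
  open Statistics rawRing y x₁ x₂ x₃ x₄ using (monomial; weight)
  open IntegerSolver R
  open SetoidReasoning setoid
  open TreeSeries R y x₁ x₂ x₃ x₄ using (root; rootˡ; rootʳ; treeWeight)

  monomial-+ : ∀ {d f} d₁ d₂ f₁ f₂ → d ≡ d₁ ℕ.+ d₂ →
    (∀ a b c (let γ : Word; γ = a ∷ b ∷ c ∷ []) → f γ ≡ f₁ γ ℕ.+ f₂ γ) → monomial d f ≈ monomial d₁ f₁ * monomial d₂ f₂
  monomial-+ d₁ d₂ f₁ f₂ d≡ f≡ = trans
    (*-cong (*-cong (*-cong (*-cong (^-+ y d₁ d₂ d≡) (^-+ x₁ (f₁ γ₁) (f₂ γ₁) (f≡ 1 2 3))) (^-+ x₂ (f₁ γ₂) (f₂ γ₂) (f≡ 2 1 3)))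
      (^-+ x₃ (f₁ γ₃) (f₂ γ₃) (f≡ 2 3 1))) (^-+ x₄ (f₁ γ₄) (f₂ γ₄) (f≡ 3 2 1)))
    (solve 10 (λ a a′ b b′ c c′ d d′ e e′ →
      a :* a′ :* (b :* b′) :* (c :* c′) :* (d :* d′) :* (e :* e′) :=
      a :* b :* c :* d :* e :* (a′ :* b′ :* c′ :* d′ :* e′)) refl
      (y ^ d₁) (y ^ d₂) (x₁ ^ f₁ γ₁) (x₁ ^ f₂ γ₁) (x₂ ^ f₁ γ₂) (x₂ ^ f₂ γ₂)
      (x₃ ^ f₁ γ₃) (x₃ ^ f₂ γ₃) (x₄ ^ f₁ γ₄) (x₄ ^ f₂ γ₄))
    where
    γ₁ γ₂ γ₃ γ₄ : Word
    γ₁ = 1 ∷ 2 ∷ 3 ∷ []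
    γ₂ = 2 ∷ 1 ∷ 3 ∷ []
    γ₃ = 2 ∷ 3 ∷ 1 ∷ []
    γ₄ = 3 ∷ 2 ∷ 1 ∷ []

    ^-+ : ∀ x {k} m n → k ≡ m ℕ.+ n → x ^ k ≈ x ^ m * x ^ n
    ^-+ x m n ≡.refl = ^-homo-* x m n

  window : Word → Carrier
  window π = monomial 0 (λ γ → occurs γ π)

  -- The window centred at m is the only one that meets both sides of m.
  weight-split : ∀ U {u m v} V {γ} → Order u m v γ →
    weight (U ++ u ∷ m ∷ v ∷ V) ≈ weight (U ++ u ∷ m ∷ []) * (window γ * weight (m ∷ v ∷ V))
  weight-split U {u} {m} {v} V {π} order =
    trans (monomial-+ {des (U ++ u ∷ m ∷ v ∷ V)} {λ γ → (γ -mch) (U ++ u ∷ m ∷ v ∷ V)}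
        (des (U ++ u ∷ m ∷ [])) (des (m ∷ v ∷ V))
        (λ γ → (γ -mch) (U ++ u ∷ m ∷ [])) (λ γ → occurs γ π ℕ.+ (γ -mch) (m ∷ v ∷ V)) descents matches)
      (*-congˡ (monomial-+ {f = λ γ → occurs γ π ℕ.+ (γ -mch) (m ∷ v ∷ V)} 0 (des (m ∷ v ∷ V))
        (λ γ → occurs γ π) (λ γ → (γ -mch) (m ∷ v ∷ V)) ≡.refl (λ _ _ _ → ≡.refl)))
    where
    matches : ∀ a b c (let γ : Word; γ = a ∷ b ∷ c ∷ []) → (γ -mch) (U ++ u ∷ m ∷ v ∷ V) ≡
      (γ -mch) (U ++ u ∷ m ∷ []) ℕ.+ (occurs γ π ℕ.+ (γ -mch) (m ∷ v ∷ V))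
    matches a b c = ≡.trans (mch-split a b c U u m v V)
      (≡.cong (λ ρ → (γ -mch) (U ++ u ∷ m ∷ []) ℕ.+ (occurs γ ρ ℕ.+ (γ -mch) (m ∷ v ∷ V))) (red-order order))
      where
      γ : Word
      γ = a ∷ b ∷ c ∷ []

    descents : des (U ++ u ∷ m ∷ v ∷ V) ≡ des (U ++ u ∷ m ∷ []) ℕ.+ des (m ∷ v ∷ V)
    descents = ≡.trans (≡.cong des (≡.sym (List.++-assoc U (u ∷ []) (m ∷ v ∷ V))))
      (≡.trans (des-split (U ++ u ∷ []) m (v ∷ V))
        (≡.cong (λ w → des w ℕ.+ des (m ∷ v ∷ V)) (List.++-assoc U (u ∷ []) (m ∷ []))))


  window-123 : window (1 ∷ 2 ∷ 3 ∷ []) ≈ x₁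
  window-123 = solve 1 (λ x → 1ₛ :* (x :* 1ₛ) :* 1ₛ :* 1ₛ :* 1ₛ := x) refl x₁
    where 1ₛ = con 1ℤ

  window-213 : window (2 ∷ 1 ∷ 3 ∷ []) ≈ x₂
  window-213 = solve 1 (λ x → 1ₛ :* 1ₛ :* (x :* 1ₛ) :* 1ₛ :* 1ₛ := x) refl x₂
    where 1ₛ = con 1ℤ

  window-231 : window (2 ∷ 3 ∷ 1 ∷ []) ≈ x₃
  window-231 = solve 1 (λ x → 1ₛ :* 1ₛ :* 1ₛ :* (x :* 1ₛ) :* 1ₛ := x) refl x₃
    where 1ₛ = con 1ℤ

  window-321 : window (3 ∷ 2 ∷ 1 ∷ []) ≈ x₄
  window-321 = solve 1 (λ x → 1ₛ :* 1ₛ :* 1ₛ :* 1ₛ :* (x :* 1ₛ) := x) refl x₄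
    where 1ₛ = con 1ℤ

  window-312 : window (3 ∷ 1 ∷ 2 ∷ []) ≈ 1#
  window-312 = solve 0 (1ₛ :* 1ₛ :* 1ₛ :* 1ₛ :* 1ₛ := 1ₛ) refl
    where 1ₛ = con 1ℤ

  private
    matchless : ∀ {d f} → (∀ a b c → f (a ∷ b ∷ c ∷ []) ≡ 0) → monomial d f ≈ y ^ d
    matchless {d} f≡0 rewrite f≡0 1 2 3 | f≡0 2 1 3 | f≡0 2 3 1 | f≡0 3 2 1 =
      solve 1 (λ a → a :* 1ₛ :* 1ₛ :* 1ₛ :* 1ₛ := a) refl (y ^ d)
      where 1ₛ = con 1ℤ

  weight-singleton : ∀ a → weight (a ∷ []) ≈ 1#
  weight-singleton a = matchless {0} {λ γ → (γ -mch) (a ∷ [])} λ γ₁ γ₂ γ₃ → mch-singleton γ₁ γ₂ γ₃ a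

  private
    weight-pair : ∀ {a b d} → des (a ∷ b ∷ []) ≡ d → weight (a ∷ b ∷ []) ≈ y ^ d
    weight-pair {a} {b} ≡.refl =
      matchless {des (a ∷ b ∷ [])} {λ γ → (γ -mch) (a ∷ b ∷ [])} λ γ₁ γ₂ γ₃ → mch-pair γ₁ γ₂ γ₃ a b

  weight-ascent : ∀ {a b} → a < b → weight (a ∷ b ∷ []) ≈ 1#
  weight-ascent {a} {b} a<b = weight-pair {a} {b} (des-ascent a<b)

  weight-descent : ∀ {a b} → b < a → weight (a ∷ b ∷ []) ≈ y
  weight-descent {a} {b} b<a = trans (weight-pair {a} {b} (des-descent b<a)) (*-identityʳ y)

  weight-root : ∀ {c X Z m} → Frame c X Z m → weight (X ++ m ∷ Z) ≈ root c
  weight-root {m = m} bare     = weight-singleton m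
  weight-root (right p)        = weight-ascent p
  weight-root (left p)         = weight-descent p
  weight-root (left<right p q) = trans (weight-split [] [] (213-order p q))
    (*-cong (weight-descent p) (trans (*-cong window-213 (weight-ascent (ℕ.<-trans p q))) (*-identityʳ x₂)))
  weight-root (left>right p q) = trans (weight-split [] [] (312-order p q))
    (trans (*-cong (weight-descent (ℕ.<-trans p q)) (trans (*-cong window-312 (weight-ascent p)) (*-identityˡ 1#)))
      (*-identityʳ y))

  private
    weight-ascending : ∀ U {u m z} → u < m → m < z →
      weight (U ++ u ∷ m ∷ z ∷ []) ≈ x₁ * weight (U ++ u ∷ m ∷ [])
    weight-ascending U u<m m<z = trans (weight-split U [] (123-order u<m m<z))
      (trans (*-congˡ (trans (*-cong window-123 (weight-ascent m<z)) (*-identityʳ x₁))) (*-comm _ _))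

    weight-descending : ∀ V {x m v} → v < m → m < x → weight (x ∷ m ∷ v ∷ V) ≈ y * x₄ * weight (m ∷ v ∷ V)
    weight-descending V v<m m<x = trans (weight-split [] V (321-order v<m m<x))
      (trans (*-cong (weight-descent m<x) (*-congʳ window-321)) (sym (*-assoc _ _ _)))

  -- With the right block empty the window centred at `m` is `u`, `m` and the right neighbour, if
  -- any: an ascending one, worth x₁. In `weight-rootʳ` it descends from the left neighbour and is
  -- worth x₄, and the descent into `m` adds y.
  weight-rootˡ : ∀ {c X Z m} U {u} → Frame c X Z m → u < m →
    weight ((X ++ U) ++ u ∷ m ∷ Z) ≈ rootˡ c * weight ((X ++ U) ++ u ∷ m ∷ [])
  weight-rootˡ U bare                       u<m = sym (*-identityˡ _)
  weight-rootˡ U (right m<z)                u<m = weight-ascending U u<m m<z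
  weight-rootˡ U (left m<x)                 u<m = sym (*-identityˡ _)
  weight-rootˡ U (left<right {x = x} p q)   u<m = weight-ascending (x ∷ U) u<m (ℕ.<-trans p q)
  weight-rootˡ U (left>right {x = x} m<z _) u<m = weight-ascending (x ∷ U) u<m m<z

  weight-rootʳ : ∀ {c X Z m v} V → Frame c X Z m → v < m →
    weight (X ++ m ∷ v ∷ V) ≈ rootʳ c * weight (m ∷ v ∷ V)
  weight-rootʳ V bare               v<m = sym (*-identityˡ _)
  weight-rootʳ V (right _)          v<m = sym (*-identityˡ _)
  weight-rootʳ V (left m<x)         v<m = weight-descending V v<m m<x
  weight-rootʳ V (left<right m<x _) v<m = weight-descending V v<m m<x
  weight-rootʳ V (left>right p q)   v<m = weight-descending V v<m (ℕ.<-trans p q)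

  private
    1ₛ : ∀ {n} → Polynomial n
    1ₛ = con 1ℤ

    0ₛ : ∀ {n} → Polynomial n
    0ₛ = con 0ℤ

    regroup : ∀ (X U : Word) u T → X ++ (U ++ u ∷ []) ++ T ≡ (X ++ U) ++ u ∷ T
    regroup X U u T = ≡.trans (≡.cong (X ++_) (List.++-assoc U (u ∷ []) T)) (≡.sym (List.++-assoc X U (u ∷ T)))

  -- Cutting at the maximum leaves its left block framed by `X` and the maximum, and its right block
  -- framed by the maximum and `Z`: again framed blocks, so the framing letters are carried through
  -- the induction.
  weight-word : ∀ {c X Z} o l r → Frame c X Z (o ℕ.+ size (node l r)) →
    weight (X ++ word o (node l r) ++ Z) ≈ treeWeight c (node l r)
  weight-word {c} {X} {Z} o l r frame = byShape l r (word-range (o ℕ.+ size r) l) (word-range o r)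
    (≡.subst (Frame c X Z) (≡.sym (maximum≡ o l r)) frame)
    where
    byShape : ∀ l r (let m = suc (o ℕ.+ size r ℕ.+ size l)) →
      All (_∈⟨ o ℕ.+ size r , o ℕ.+ size r ℕ.+ size l ]) (word (o ℕ.+ size r) l) → All (_∈⟨ o , o ℕ.+ size r ]) (word o r) →
      Frame c X Z m → weight (X ++ word o (node l r) ++ Z) ≈ treeWeight c (node l r)
    byShape leaf leaf _ _ frame = trans (weight-root frame)
      (solve 4 (λ a b c d → a := a :* (1ₛ :* 1ₛ) :+ b :* (0ₛ :* 1ₛ) :+ c :* (1ₛ :* 0ₛ) :+ d :* (0ₛ :* 0ₛ))
        refl (root c) (rootˡ c) (rootʳ c) x₃)
    byShape l@(node l₁ l₂) leaf Ls _ frame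
      -- The induction hypothesis is bound before the block is rewritten as `U ++ u ∷ []`, so that
      -- the rewriting reaches it too.
      with IH ← weight-word (o ℕ.+ 0) l₁ l₂ (frameˡ frame)
      with U , u , eq , _ , u≤ ← unsnoc (word-node≢[] (o ℕ.+ 0) l₁ l₂) Ls
      rewrite eq = let m = suc (o ℕ.+ 0 ℕ.+ size l) in begin
        weight (X ++ ((U ++ u ∷ []) ++ m ∷ []) ++ Z)
          ≡⟨ ≡.cong (λ w → weight (X ++ w)) (List.++-assoc (U ++ u ∷ []) (m ∷ _) Z) ⟩
        weight (X ++ (U ++ u ∷ []) ++ m ∷ Z)         ≡⟨ ≡.cong weight (regroup X U u (m ∷ _)) ⟩
        weight ((X ++ U) ++ u ∷ m ∷ Z)               ≈⟨ weight-rootˡ U frame (s≤s u≤) ⟩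
        rootˡ c * weight ((X ++ U) ++ u ∷ m ∷ [])    ≡⟨ ≡.cong (λ w → rootˡ c * weight w) (regroup X U u (m ∷ _)) ⟨
        rootˡ c * weight (X ++ (U ++ u ∷ []) ++ m ∷ [])   ≈⟨ *-congˡ IH ⟩
        rootˡ c * treeWeight (contextˡ c) l
          ≈⟨ solve 5 (λ a b c d w → b :* w := a :* (0ₛ :* 1ₛ) :+ b :* (w :* 1ₛ) :+ c :* (0ₛ :* 0ₛ) :+ d :* (w :* 0ₛ))
               refl (root c) (rootˡ c) (rootʳ c) x₃ (treeWeight (contextˡ c) l) ⟩
        treeWeight c (node l leaf) ∎
    byShape leaf r@(node r₁ r₂) _ Rs frame
      with IH ← weight-word o r₁ r₂ (frameʳ (s≤s (ℕ.m≤m+n (o ℕ.+ size r) 0)) frame)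
      with v , V , eq , _ , v≤ ← uncons (word-node≢[] o r₁ r₂) Rs
      rewrite eq = let m = suc (o ℕ.+ size r ℕ.+ 0) in begin
        weight (X ++ m ∷ v ∷ V ++ Z)                 ≈⟨ weight-rootʳ (V ++ Z) frame (s≤s (ℕ.≤-trans v≤ (ℕ.m≤m+n _ 0))) ⟩
        rootʳ c * weight (m ∷ v ∷ V ++ Z)            ≈⟨ *-congˡ IH ⟩
        rootʳ c * treeWeight (contextʳ c) r
          ≈⟨ solve 5 (λ a b c d w → c :* w := a :* (1ₛ :* 0ₛ) :+ b :* (0ₛ :* 0ₛ) :+ c :* (1ₛ :* w) :+ d :* (0ₛ :* w))
               refl (root c) (rootˡ c) (rootʳ c) x₃ (treeWeight (contextʳ c) r) ⟩
        treeWeight c (node leaf r) ∎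
    byShape l@(node l₁ l₂) r@(node r₁ r₂) Ls Rs frame
      with IHˡ ← weight-word (o ℕ.+ size r) l₁ l₂ (frameˡ frame)
      with IHʳ ← weight-word o r₁ r₂ (frameʳ (s≤s (ℕ.m≤m+n (o ℕ.+ size r) (size l))) frame)
      with U , u , eqˡ , <u , u≤ ← unsnoc (word-node≢[] (o ℕ.+ size r) l₁ l₂) Ls
      with v , V , eqʳ , _ , v≤ ← uncons (word-node≢[] o r₁ r₂) Rs
      rewrite eqˡ | eqʳ = let m = suc (o ℕ.+ size r ℕ.+ size l) in begin
        weight (X ++ ((U ++ u ∷ []) ++ m ∷ v ∷ V) ++ Z)
          ≡⟨ ≡.cong (λ w → weight (X ++ w)) (List.++-assoc (U ++ u ∷ []) (m ∷ _) Z) ⟩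
        weight (X ++ (U ++ u ∷ []) ++ m ∷ v ∷ V ++ Z)  ≡⟨ ≡.cong weight (regroup X U u (m ∷ _)) ⟩
        weight ((X ++ U) ++ u ∷ m ∷ v ∷ V ++ Z)
          -- The letter `v` is at most `o + size r` and `u` lies above that, so two nonempty blocks
          -- always produce a 231 at the maximum.
          ≈⟨ weight-split (X ++ U) (V ++ Z) (231-order (ℕ.≤-<-trans v≤ <u) (s≤s u≤)) ⟩
        weight ((X ++ U) ++ u ∷ m ∷ []) * (window (2 ∷ 3 ∷ 1 ∷ []) * weight (m ∷ v ∷ V ++ Z))
          ≈⟨ *-cong (trans (reflexive (≡.cong weight (≡.sym (regroup X U u (m ∷ _))))) IHˡ) (*-cong window-231 IHʳ) ⟩
        treeWeight (contextˡ c) l * (x₃ * treeWeight (contextʳ c) r)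
          ≈⟨ solve 6 (λ a b c d w w′ → w :* (d :* w′) :=
               a :* (0ₛ :* 0ₛ) :+ b :* (w :* 0ₛ) :+ c :* (0ₛ :* w′) :+ d :* (w :* w′))
               refl (root c) (rootˡ c) (rootʳ c) x₃ (treeWeight (contextˡ c) l) (treeWeight (contextʳ c) r) ⟩
        treeWeight c (node l r) ∎

-- Trees enumerate 132-avoiding permutations

node-injective : ∀ {l l′ r r′} → node l r ≡ node l′ r′ → l ≡ l′ × r ≡ r′
node-injective ≡.refl = ≡.refl , ≡.refl

module _ {a b c} {A : Set a} {B : Set b} {C : Set c} (f : A → B → C) where
  ∈-convolve⁺ : ∀ {F G} i {j x z} → x ∈ F i → z ∈ G j → f x z ∈ convolve f F G (i ℕ.+ j)
  ∈-convolve⁺         zero    {zero}  x∈ z∈ = ∈-cartesianProductWith⁺ f x∈ z∈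
  ∈-convolve⁺         zero    {suc j} x∈ z∈ = ∈-++⁺ˡ (∈-cartesianProductWith⁺ f x∈ z∈)
  ∈-convolve⁺ {F} {G} (suc i) {j}     x∈ z∈ =
    ∈-++⁺ʳ (cartesianProductWith f (F 0) (G (suc (i ℕ.+ j)))) (∈-convolve⁺ {F ∘ suc} i x∈ z∈)

  ∈-convolve⁻ : ∀ F G n {w} → w ∈ convolve f F G n →
    ∃₂ λ i j → i ℕ.+ j ≡ n × ∃₂ λ x z → x ∈ F i × z ∈ G j × w ≡ f x z
  ∈-convolve⁻ F G zero    w∈ with x , z , x∈ , z∈ , eq ← ∈-cartesianProductWith⁻ f (F 0) (G 0) w∈ =
    0 , 0 , ≡.refl , x , z , x∈ , z∈ , eq
  ∈-convolve⁻ F G (suc n) w∈ with ∈-++⁻ (cartesianProductWith f (F 0) (G (suc n))) w∈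
  ... | inj₁ w∈ with x , z , x∈ , z∈ , eq ← ∈-cartesianProductWith⁻ f (F 0) (G (suc n)) w∈ =
    0 , suc n , ≡.refl , x , z , x∈ , z∈ , eq
  ... | inj₂ w∈ with i , j , i+j≡n , rest ← ∈-convolve⁻ (F ∘ suc) G n w∈ = suc i , j , ≡.cong suc i+j≡n , rest

-- Trees from different summands have left subtrees of different sizes. The offset `k` records how
-- far `F` has been shifted by the recursion.
convolve-unique : ∀ k {F G} n → (∀ i → Unique (F i)) → (∀ i → Unique (G i)) →
  (∀ i {l} → l ∈ F i → size l ≡ k ℕ.+ i) → Unique (convolve node F G n)
convolve-unique k         zero    F! G! size-F = Unique.cartesianProductWith⁺ node node-injective (F! 0) (G! 0)
convolve-unique k {F} {G} (suc n) F! G! size-F = Unique.++⁺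
  (Unique.cartesianProductWith⁺ node node-injective (F! 0) (G! (suc n)))
  (convolve-unique (suc k) n (F! ∘ suc) G! (λ i l∈ → ≡.trans (size-F (suc i) l∈) (ℕ.+-suc k i)))
  disjoint
  where
  disjoint : Disjoint (cartesianProductWith node (F 0) (G (suc n))) (convolve node (F ∘ suc) G n)
  disjoint (t∈₁ , t∈₂)
    with l , r , l∈ , _ , ≡.refl ← ∈-cartesianProductWith⁻ node (F 0) (G (suc n)) t∈₁
    with i , _ , _ , _ , _ , l′∈ , _ , ≡.refl ← ∈-convolve⁻ node (F ∘ suc) G n t∈₂
    with () ← ℕ.+-cancelˡ-≡ k 0 (suc i) (≡.trans (≡.sym (size-F 0 l∈)) (size-F (suc i) l′∈))

∈-forest⁻ : ∀ h n {t} → t ∈ forest h n → size t ≡ n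
∈-forest⁻ (suc h) zero    (here ≡.refl) = ≡.refl
∈-forest⁻ (suc h) (suc n) t∈ with i , j , i+j≡n , l , r , l∈ , r∈ , ≡.refl ← ∈-convolve⁻ node (forest h) (forest h) n t∈ =
  ≡.cong suc (≡.trans (≡.cong₂ ℕ._+_ (∈-forest⁻ h i l∈) (∈-forest⁻ h j r∈)) i+j≡n)

∈-forest⁺ : ∀ {h} t → size t < h → t ∈ forest h (size t)
∈-forest⁺ {suc h} leaf       _      = here ≡.refl
∈-forest⁺ {suc h} (node l r) (s≤s p) = ∈-convolve⁺ node {forest h} (size l)
  (∈-forest⁺ l (ℕ.≤-trans (s≤s (ℕ.m≤m+n (size l) (size r))) p))
  (∈-forest⁺ r (ℕ.≤-trans (s≤s (ℕ.m≤n+m (size r) (size l))) p))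

forest-unique : ∀ h n → Unique (forest h n)
forest-unique zero    n       = []
forest-unique (suc h) zero    = [] ∷ []
forest-unique (suc h) (suc n) = convolve-unique 0 n (forest-unique h) (forest-unique h) (∈-forest⁻ h)

AllPairs-++⁻ : ∀ {a ℓ} {A : Set a} {R : Rel A ℓ} xs {ys} → AllPairs R (xs ++ ys) →
  AllPairs R xs × AllPairs R ys × All (λ x → All (R x) ys) xs
AllPairs-++⁻ []       ps       = [] , ps , []
AllPairs-++⁻ (x ∷ xs) (p ∷ ps) with qs , rs , ss ← AllPairs-++⁻ xs ps =
  All.++⁻ˡ xs p ∷ qs , rs , All.++⁻ʳ xs p ∷ ss

-- Distinct letters in an interval

private
  below : ∀ {o k a} → a ∈⟨ o , o ℕ.+ suc k ] × a ≢ o ℕ.+ suc k → a ∈⟨ o , o ℕ.+ k ]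
  below {o} {k} {a} ((lo , hi) , a≢) = lo , s≤s⁻¹ (≡.subst (a <_) (ℕ.+-suc o k) (ℕ.≤∧≢⇒< hi a≢))

  -- Induction on the size of the interval: its top value occurs at most once, and deleting it
  -- leaves a word over the shorter interval.
  pigeonhole′ : ∀ o k {w} → Unique w → All (_∈⟨ o , o ℕ.+ k ]) w → length w ≤ k
  pigeonhole′ o zero    {[]}    _  _             = z≤n
  pigeonhole′ o zero    {a ∷ w} _  ((lo , hi) ∷ _) =
    contradiction (ℕ.≤-trans hi (ℕ.≤-reflexive (ℕ.+-identityʳ o))) (ℕ.<⇒≱ lo)
  pigeonhole′ o (suc k) {w}     w! ranges with any? (o ℕ.+ suc k ℕ.≟_) w
  ... | no ∉w = ℕ.m≤n⇒m≤1+n (pigeonhole′ o k w! (All.tabulate λ a∈ →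
    below (All.lookup ranges a∈ , λ { ≡.refl → ∉w a∈ })))
  ... | yes ∈w with u , v , ≡.refl ← ∈-∃++ ∈w with u! , (m∉v ∷ v!) , u#mv ← AllPairs-++⁻ u w! =
    ≡.subst (_≤ suc k) (≡.sym (≡.trans (List.length-++ u) (ℕ.+-suc (length u) (length v))))
      (s≤s (≡.subst (_≤ k) (List.length-++ u) (pigeonhole′ o k (AllPairs.++⁺ u! v! (All.map All.tail u#mv))
        (All.++⁺ (All.zipWith below (All.++⁻ˡ u ranges , All.map (All.head) u#mv))
          (All.zipWith below (All.tail (All.++⁻ʳ u ranges) , All.map (_∘ ≡.sym) m∉v))))))

pigeonhole : ∀ {o u w} → o ≤ u → Unique w → All (_∈⟨ o , u ]) w → o ℕ.+ length w ≤ u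
pigeonhole {o} {u} {w} o≤u w! ranges = ≡.subst (o ℕ.+ length w ≤_) (ℕ.m+[n∸m]≡n o≤u) (ℕ.+-monoʳ-≤ o
  (pigeonhole′ o (u ℕ.∸ o) w! (≡.subst (λ u → All (_∈⟨ o , u ]) w) (≡.sym (ℕ.m+[n∸m]≡n o≤u)) ranges)))

-- Membership in the lists of words, subsequences and avoiders

∈-words⁺ : ∀ {alphabet w} → All (_∈ alphabet) w → w ∈ words alphabet (length w)
∈-words⁺ []       = here ≡.refl
∈-words⁺ (p ∷ ps) = ∈-cartesianProductWith⁺ _∷_ p (∈-words⁺ ps)

∈-words⁻ : ∀ alphabet k {w} → w ∈ words alphabet k → length w ≡ k × All (_∈ alphabet) w
∈-words⁻ alphabet zero    (here ≡.refl) = ≡.refl , []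
∈-words⁻ alphabet (suc k) w∈
  with a , u , a∈ , u∈ , ≡.refl ← ∈-cartesianProductWith⁻ _∷_ alphabet (words alphabet k) w∈
  with ≡.refl , ps ← ∈-words⁻ alphabet k u∈ = ≡.refl , a∈ ∷ ps

words-unique : ∀ {alphabet} k → Unique alphabet → Unique (words alphabet k)
words-unique zero    alphabet! = [] ∷ []
words-unique (suc k) alphabet! = Unique.cartesianProductWith⁺ _∷_ List.∷-injective alphabet! (words-unique k alphabet!)

∈-subsequences⁺ : ∀ {w σ} → w ⊆ σ → w ∈ subsequences σ
∈-subsequences⁺                 []           = here ≡.refl
∈-subsequences⁺ {σ = b ∷ σ} (.b ∷ʳ w⊆) = ∈-++⁺ʳ (map (b ∷_) (subsequences σ)) (∈-subsequences⁺ w⊆)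
∈-subsequences⁺                 (≡.refl ∷ w⊆)  = ∈-++⁺ˡ (∈-map⁺ _ (∈-subsequences⁺ w⊆))

∈-subsequences⁻ : ∀ σ {w} → w ∈ subsequences σ → w ⊆ σ
∈-subsequences⁻ []      (here ≡.refl) = []
∈-subsequences⁻ (b ∷ σ) w∈ with ∈-++⁻ (map (b ∷_) (subsequences σ)) w∈
... | inj₂ w∈ = b ∷ʳ ∈-subsequences⁻ σ w∈
... | inj₁ w∈ with _ , u∈ , ≡.refl ← ∈-map⁻ (b ∷_) w∈ = ≡.refl ∷ ∈-subsequences⁻ σ u∈

132-Free : Word → Set
132-Free σ = ∀ {a b c} → a ∷ b ∷ c ∷ [] ⊆ σ → a < c → c < b → ⊥

private
  -- Each of the five other strict orders reduces to its own pattern, and a tie gives two letters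
  -- the same rank.
  132-letters : ∀ a b c → red (a ∷ b ∷ c ∷ []) ≡ 1 ∷ 3 ∷ 2 ∷ [] → a < c × c < b
  132-letters a b c eq with ℕ.<-cmp a b | ℕ.<-cmp b c | ℕ.<-cmp a c
  ... | tri< _ _ _ | tri> _ _ c<b | tri< a<c _ _ = a<c , c<b
  ... | tri< a<b _ _ | tri< b<c _ _ | _ = contradiction (≡.trans (≡.sym eq) (red-order (123-order a<b b<c))) λ ()
  ... | tri< a<b _ _ | _ | tri> _ _ c<a = contradiction (≡.trans (≡.sym eq) (red-order (231-order c<a a<b))) λ ()
  ... | tri> _ _ b<a | tri> _ _ c<b | _ = contradiction (≡.trans (≡.sym eq) (red-order (321-order c<b b<a))) λ ()
  ... | tri> _ _ b<a | _ | tri< a<c _ _ = contradiction (≡.trans (≡.sym eq) (red-order (213-order b<a a<c))) λ ()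
  ... | _ | tri< b<c _ _ | tri> _ _ c<a = contradiction (≡.trans (≡.sym eq) (red-order (312-order b<c c<a))) λ ()
  ... | tri≈ _ ≡.refl _ | _ | _ with e₁ , e₂ ← List.∷-injective (≡.trans (≡.sym (red-triple a b c)) eq) =
    contradiction (≡.trans (≡.sym e₁) (List.∷-injectiveˡ e₂)) λ ()
  ... | _ | tri≈ _ ≡.refl _ | _ with _ , e₂ ← List.∷-injective (≡.trans (≡.sym (red-triple a b c)) eq) =
    contradiction (≡.trans (≡.sym (List.∷-injectiveˡ e₂)) (List.∷-injectiveˡ (List.∷-injectiveʳ e₂))) λ ()
  ... | _ | _ | tri≈ _ ≡.refl _ with e₁ , e₂ ← List.∷-injective (≡.trans (≡.sym (red-triple a b c)) eq) =
    contradiction (≡.trans (≡.sym e₁) (List.∷-injectiveˡ (List.∷-injectiveʳ e₂))) λ ()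

avoids⇒132-free : ∀ {σ} → Avoids (1 ∷ 3 ∷ 2 ∷ []) σ → 132-Free σ
avoids⇒132-free avoids w⊆ a<c c<b = All.lookup avoids (∈-subsequences⁺ w⊆) (red-order (132-order a<c c<b))

132-free⇒avoids : ∀ {σ} → 132-Free σ → Avoids (1 ∷ 3 ∷ 2 ∷ []) σ
132-free⇒avoids {σ} free = All.tabulate λ {w} w∈ eq → absurd w (∈-subsequences⁻ σ w∈) eq
  where
  absurd : ∀ w → w ⊆ σ → red w ≢ 1 ∷ 3 ∷ 2 ∷ []
  absurd (a ∷ b ∷ c ∷ []) w⊆ eq with a<c , c<b ← 132-letters a b c eq = free w⊆ a<c c<b

letters : ∀ {n a} → a ∈⟨ 0 , n ] → a ∈ map suc (upTo n)
letters {a = suc a} (_ , hi) = ∈-map⁺ suc (∈-upTo⁺ hi)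

letters⁻ : ∀ {n a} → a ∈ map suc (upTo n) → a ∈⟨ 0 , n ]
letters⁻ a∈ with _ , i∈ , ≡.refl ← ∈-map⁻ suc a∈ = s≤s z≤n , ∈-upTo⁻ i∈

record IsAvoider (o n : ℕ) (σ : Word) : Set where
  constructor isAvoider
  field
    length≡ : length σ ≡ n
    ranges  : All (_∈⟨ o , o ℕ.+ n ]) σ
    unique  : Unique σ
    free    : 132-Free σ

∈-𝒮⁺ : ∀ {n σ} → IsAvoider 0 n σ → σ ∈ 𝒮⟨ 1 ∷ 3 ∷ 2 ∷ [] ⟩ n
∈-𝒮⁺ (isAvoider ≡.refl ranges σ! free) = ∈-filter⁺ (avoids? (1 ∷ 3 ∷ 2 ∷ []))
  (∈-filter⁺ (DecUnique.unique? ℕ._≟_) (∈-words⁺ (All.map letters ranges)) σ!) (132-free⇒avoids free)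

∈-𝒮⁻ : ∀ {n σ} → σ ∈ 𝒮⟨ 1 ∷ 3 ∷ 2 ∷ [] ⟩ n → IsAvoider 0 n σ
∈-𝒮⁻ {n} σ∈
  with σ∈𝒮 , avoids ← ∈-filter⁻ (avoids? (1 ∷ 3 ∷ 2 ∷ [])) {xs = 𝒮 n} σ∈
  with σ∈ , σ! ← ∈-filter⁻ (DecUnique.unique? ℕ._≟_) {xs = words (map suc (upTo n)) n} σ∈𝒮
  with eq , ps ← ∈-words⁻ (map suc (upTo n)) n σ∈ = isAvoider eq (All.map letters⁻ ps) σ! (avoids⇒132-free avoids)

𝒮-unique : ∀ n → Unique (𝒮⟨ 1 ∷ 3 ∷ 2 ∷ [] ⟩ n)
𝒮-unique n = Unique.filter⁺ (avoids? (1 ∷ 3 ∷ 2 ∷ [])) (Unique.filter⁺ (DecUnique.unique? ℕ._≟_)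
  (words-unique n (Unique.map⁺ ℕ.suc-injective (Unique.upTo⁺ n))))

-- Words of trees avoid 132 and determine the tree

⊆-++⁻ : ∀ {a} {A : Set a} (xs : List A) {ys ws} → ws ⊆ xs ++ ys → ∃₂ λ us vs → ws ≡ us ++ vs × us ⊆ xs × vs ⊆ ys
⊆-++⁻ []       ws⊆           = [] , _ , ≡.refl , [] , ws⊆
⊆-++⁻ (x ∷ xs) (.x ∷ʳ ws⊆)   with us , vs , eq , us⊆ , vs⊆ ← ⊆-++⁻ xs ws⊆ = us , vs , eq , x ∷ʳ us⊆ , vs⊆
⊆-++⁻ (x ∷ xs) (≡.refl ∷ ws⊆)  with us , vs , eq , us⊆ , vs⊆ ← ⊆-++⁻ xs ws⊆ =
  x ∷ us , vs , ≡.cong (x ∷_) eq , ≡.refl ∷ us⊆ , vs⊆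

⊆-∷⁻ : ∀ {a} {A : Set a} {m b c : A} {R ws} → b ∷ c ∷ ws ⊆ m ∷ R → c ∈ R
⊆-∷⁻ (_ ∷ʳ ⊆R) = lookup ⊆R (there (here ≡.refl))
⊆-∷⁻ (_ ∷ ⊆R)  = lookup ⊆R (here ≡.refl)

-- In an occurrence a b c of 132 neither a nor c can be the maximum `m`, as b or c exceeds it, and a
-- in `L` with c in `R` contradicts a < c. What remains lies within `L` or within `R`.
132-free-node : ∀ {L m R} → All (_< m) L → All (_< m) R → All (λ a → All (_< a) R) L →
  132-Free L → 132-Free R → 132-Free (L ++ m ∷ R)
132-free-node {L} L<m R<m R<L free-L free-R w⊆ a<c c<b with ⊆-++⁻ L w⊆
... | []                , _ , ≡.refl , _  , _ ∷ʳ ⊆R   = free-R ⊆R a<c c<b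
... | []                , _ , ≡.refl , _  , ≡.refl ∷ ⊆R = ℕ.<-asym a<c (All.lookup R<m (lookup ⊆R (there (here ≡.refl))))
... | _ ∷ []            , _ , ≡.refl , ⊆L , ⊆mR       =
  ℕ.<-asym a<c (All.lookup (All.lookup R<L (to∈ ⊆L)) (⊆-∷⁻ ⊆mR))
... | _ ∷ _ ∷ []        , _ , ≡.refl , ⊆L , ≡.refl ∷ _  = ℕ.<-asym c<b (All.lookup L<m (lookup ⊆L (there (here ≡.refl))))
... | _ ∷ _ ∷ []        , _ , ≡.refl , ⊆L , _ ∷ʳ ⊆R   =
  ℕ.<-asym a<c (All.lookup (All.lookup R<L (lookup ⊆L (here ≡.refl))) (to∈ ⊆R))
... | _ ∷ _ ∷ _ ∷ []    , _ , ≡.refl , ⊆L , _         = free-L ⊆L a<c c<b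

word-isAvoider : ∀ o t → IsAvoider o (size t) (word o t)
word-isAvoider o leaf       = isAvoider ≡.refl [] [] λ ()
word-isAvoider o (node l r) = record
  { length≡ = length-word o (node l r)
  ; ranges  = word-range o (node l r)
  ; unique  = AllPairs.++⁺ (IsAvoider.unique ihˡ) (All.map ℕ.>⇒≢ R<m ∷ IsAvoider.unique ihʳ)
      (All.zipWith (λ (a<m , R<a) → ℕ.<⇒≢ a<m ∷ All.map ℕ.>⇒≢ R<a) (L<m , R<L))
  ; free    = 132-free-node L<m R<m R<L (IsAvoider.free ihˡ) (IsAvoider.free ihʳ)
  }
  where
  ihˡ = word-isAvoider (o ℕ.+ size r) l
  ihʳ = word-isAvoider o r
  L<m = All.map (λ (_ , hi) → s≤s hi) (word-range (o ℕ.+ size r) l)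
  R<m = All.map (λ (_ , hi) → s≤s (ℕ.≤-trans hi (ℕ.m≤m+n (o ℕ.+ size r) (size l)))) (word-range o r)
  R<L = All.map (λ (lo , _) → All.map (λ (_ , hi) → ℕ.≤-<-trans hi lo) (word-range o r)) (word-range (o ℕ.+ size r) l)

++-∷-injective : ∀ {a} {A : Set a} {m : A} L L′ {R R′} → m ∉ L → m ∉ L′ →
  L ++ m ∷ R ≡ L′ ++ m ∷ R′ → L ≡ L′ × R ≡ R′
++-∷-injective []      []        _  _   eq = ≡.refl , List.∷-injectiveʳ eq
++-∷-injective []      (a ∷ L′)  _  m∉′ eq = contradiction (here (List.∷-injectiveˡ eq)) m∉′
++-∷-injective (a ∷ L) []        m∉ _   eq = contradiction (here (≡.sym (List.∷-injectiveˡ eq))) m∉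
++-∷-injective (a ∷ L) (a′ ∷ L′) m∉ m∉′ eq with ≡.refl , eq′ ← List.∷-injective eq
  with ≡.refl , R≡ ← ++-∷-injective L L′ (m∉ ∘ there) (m∉′ ∘ there) eq′ = ≡.refl , R≡

maximum-fresh : ∀ o l r → suc (o ℕ.+ size r ℕ.+ size l) ∉ word (o ℕ.+ size r) l
maximum-fresh o l r m∈ = ℕ.1+n≰n (proj₂ (All.lookup (word-range (o ℕ.+ size r) l) m∈))

word-size : ∀ {o} t t′ → word o t ≡ word o t′ → size t ≡ size t′
word-size {o} t t′ eq = ≡.trans (≡.sym (length-word o t)) (≡.trans (≡.cong length eq) (length-word o t′))

word-injective : ∀ {o} t t′ → word o t ≡ word o t′ → t ≡ t′
word-injective     leaf         leaf           eq = ≡.refl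
word-injective {o} leaf         (node l r)     eq = contradiction (≡.sym eq) (word-node≢[] o l r)
word-injective {o} (node l r)   leaf           eq = contradiction eq (word-node≢[] o l r)
word-injective {o} t@(node l r) t′@(node l′ r′) eq
  -- Equal words have equal lengths, so the maxima agree before anything is known about the
  -- subtrees; cutting both words at this letter is then unambiguous.
  with max≡ ← ≡.trans (maximum≡ o l r) (≡.trans (≡.cong (o ℕ.+_) (word-size t t′ eq)) (≡.sym (maximum≡ o l′ r′)))
  with L≡ , R≡ ← ++-∷-injective (word (o ℕ.+ size r) l) (word (o ℕ.+ size r′) l′) (maximum-fresh o l r)
    (≡.subst (_∉ word (o ℕ.+ size r′) l′) (≡.sym max≡) (maximum-fresh o l′ r′))
    (≡.trans eq (≡.cong (λ m → word (o ℕ.+ size r′) l′ ++ m ∷ word o r′) (≡.sym max≡)))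
  -- The right subtrees come first, because their size is the offset of the left blocks.
  with ≡.refl ← word-injective r r′ R≡
  with ≡.refl ← word-injective l l′ L≡ = ≡.refl

-- Splitting an avoider at its maximum

maximum∈ : ∀ {o n σ} → IsAvoider o (suc n) σ → o ℕ.+ suc n ∈ σ
maximum∈ {o} {n} {σ} (isAvoider length≡ ranges σ! _) with any? (o ℕ.+ suc n ℕ.≟_) σ
... | yes ∈σ = ∈σ
-- Without the top value only `n` values remain for `n + 1` distinct letters.
... | no  ∉σ = contradiction (≡.subst (_≤ n) length≡ (pigeonhole′ o n σ! (All.tabulate λ a∈ →
    below (All.lookup ranges a∈ , λ { ≡.refl → ∉σ a∈ })))) ℕ.1+n≰n

record Split (o n : ℕ) (σ : Word) : Set where
  field
    L R      : Word
    σ≡       : σ ≡ L ++ o ℕ.+ suc n ∷ R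
    lengths  : length L ℕ.+ length R ≡ n
    avoiderˡ : IsAvoider (o ℕ.+ length R) (length L) L
    avoiderʳ : IsAvoider o (length R) R

-- Avoiding 132 forces every letter left of the maximum above every letter right of it; by the pigeonhole
-- principle both blocks are then intervals.
split : ∀ {o n σ} → IsAvoider o (suc n) σ → Split o n σ
split {o} {n} {σ} av@(isAvoider length≡ ranges σ! free)
  with L , R , ≡.refl ← ∈-∃++ (maximum∈ av)
  with L! , (m∉R ∷ R!) , L#mR ← AllPairs-++⁻ L σ! = record
  { L = L ; R = R ; σ≡ = ≡.refl ; lengths = lengths
  ; avoiderˡ = isAvoider ≡.refl (All.tabulate λ l∈ → lowˡ l∈ , highˡ l∈) L! λ w⊆ → free (++⁺ w⊆ (minimum _))
  ; avoiderʳ = isAvoider ≡.refl (All.tabulate λ r∈ → proj₁ (rangeʳ r∈) , highʳ r∈) R! λ w⊆ → free (++⁺ (minimum L) (_ ∷ʳ w⊆))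
  }
  where
  lengths : length L ℕ.+ length R ≡ n
  lengths = ℕ.suc-injective (≡.trans (≡.sym (ℕ.+-suc (length L) (length R))) (≡.trans (≡.sym (List.length-++ L)) length≡))

  rangeˡ : ∀ {l} → l ∈ L → l ∈⟨ o , o ℕ.+ n ]
  rangeˡ l∈ = below (All.lookup ranges (∈-++⁺ˡ l∈) , All.head (All.lookup L#mR l∈))

  rangeʳ : ∀ {r} → r ∈ R → r ∈⟨ o , o ℕ.+ n ]
  rangeʳ r∈ = below (All.lookup ranges (∈-++⁺ʳ L (there r∈)) , All.lookup m∉R r∈ ∘ ≡.sym)

  r<l : ∀ {l r} → l ∈ L → r ∈ R → r < l
  r<l {l} {r} l∈ r∈ with ℕ.<-cmp l r
  ... | tri> _ _ r<l  = r<l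
  ... | tri≈ _ ≡.refl _ = contradiction ≡.refl (All.lookup (All.tail (All.lookup L#mR l∈)) r∈)
  -- Otherwise `l`, the maximum and `r` form a 132.
  ... | tri< l<r _ _  = contradiction
    (≡.subst (r <_) (≡.sym (ℕ.+-suc o n)) (s≤s (proj₂ (rangeʳ r∈)))) (free (++⁺ (from∈ l∈) (≡.refl ∷ from∈ r∈)) l<r)

  o+n≡ : o ℕ.+ n ≡ o ℕ.+ length R ℕ.+ length L
  o+n≡ = ≡.trans (≡.cong (o ℕ.+_) (≡.trans (≡.sym lengths) (ℕ.+-comm (length L) (length R)))) (≡.sym (ℕ.+-assoc o _ _))

  lowˡ : ∀ {l} → l ∈ L → o ℕ.+ length R < l
  lowˡ {zero}  l∈ = contradiction (proj₁ (rangeˡ l∈)) λ ()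
  -- All letters of `R` lie above `o` and below the given letter of `L`, so there must be room for
  -- `length R` values between them.
  lowˡ {suc l} l∈ = s≤s (pigeonhole (s≤s⁻¹ (proj₁ (rangeˡ l∈))) R!
    (All.tabulate λ r∈ → proj₁ (rangeʳ r∈) , s≤s⁻¹ (r<l l∈ r∈)))

  highˡ : ∀ {l} → l ∈ L → l ≤ o ℕ.+ length R ℕ.+ length L
  highˡ {l} l∈ = ≡.subst (l ≤_) o+n≡ (proj₂ (rangeˡ l∈))

  highʳ : ∀ {r} → r ∈ R → r ≤ o ℕ.+ length R
  -- Dually, the `length L` letters of `L` fit between `r` and `o + n`.
  highʳ {r} r∈ = ℕ.+-cancelʳ-≤ (length L) r (o ℕ.+ length R) (≡.subst (r ℕ.+ length L ≤_) o+n≡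
    (pigeonhole (proj₂ (rangeʳ r∈)) L! (All.tabulate λ l∈ → r<l l∈ r∈ , proj₂ (rangeˡ l∈))))

private
  -- The blocks returned by `split` are not structural parts of `σ`, so the recursion runs on the
  -- bound `k`.
  parse′ : ∀ k {o n σ} → n ≤ k → IsAvoider o n σ → ∃ λ t → size t ≡ n × word o t ≡ σ
  parse′ _       {n = zero} {[]} _       _  = leaf , ≡.refl , ≡.refl
  parse′ (suc k) {o} {suc n} {σ} (s≤s n≤k) av
    with record { L = L ; R = R ; σ≡ = ≡.refl ; lengths = lengths ; avoiderˡ = avˡ ; avoiderʳ = avʳ } ← split av
    with l , sizeˡ , wordˡ ← parse′ k (ℕ.≤-trans (ℕ.≤-trans (ℕ.m≤m+n _ _) (ℕ.≤-reflexive lengths)) n≤k) avˡ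
    with r , sizeʳ , wordʳ ← parse′ k (ℕ.≤-trans (ℕ.≤-trans (ℕ.m≤n+m _ (length L)) (ℕ.≤-reflexive lengths)) n≤k) avʳ =
    node l r , size≡ , ≡.cong₂ (λ u v → u ++ v)
      (≡.trans (≡.cong (λ j → word (o ℕ.+ j) l) sizeʳ) wordˡ)
      (≡.cong₂ _∷_ (≡.trans (maximum≡ o l r) (≡.cong (o ℕ.+_) size≡)) wordʳ)
    where
    size≡ = ≡.cong suc (≡.trans (≡.cong₂ ℕ._+_ sizeˡ sizeʳ) lengths)

parse : ∀ {o n σ} → IsAvoider o n σ → ∃ λ t → size t ≡ n × word o t ≡ σ
parse = parse′ _ ℕ.≤-refl

-- Two duplicate-free lists with the same members are permutations of each other, and a sum of
-- weights does not see the order.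
words-of-trees↭ : ∀ n → map (word 0) (trees n) ↭ 𝒮⟨ 1 ∷ 3 ∷ 2 ∷ [] ⟩ n
words-of-trees↭ n = ∼bag⇒↭ (unique∧set⇒bag
  (Unique.map⁺ (word-injective _ _) (forest-unique (suc n) n)) (𝒮-unique n) (mk⇔ to from))
  where
  to : ∀ {σ} → σ ∈ map (word 0) (trees n) → σ ∈ 𝒮⟨ 1 ∷ 3 ∷ 2 ∷ [] ⟩ n
  to σ∈ with t , t∈ , ≡.refl ← ∈-map⁻ (word 0) σ∈ =
    ∈-𝒮⁺ (≡.subst (λ k → IsAvoider 0 k (word 0 t)) (∈-forest⁻ (suc n) n t∈) (word-isAvoider 0 t))

  from : ∀ {σ} → σ ∈ 𝒮⟨ 1 ∷ 3 ∷ 2 ∷ [] ⟩ n → σ ∈ map (word 0) (trees n)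
  from σ∈ with t , size≡ , ≡.refl ← parse (∈-𝒮⁻ {n} σ∈) =
    ∈-map⁺ (word 0) (≡.subst (λ k → t ∈ trees k) size≡ (∈-forest⁺ t ℕ.≤-refl))

-- The generating function

module _ {c ℓ} (Q : RawRing c ℓ) (y x₁ x₂ x₃ x₄ : RawRing.Carrier Q) where
  open RawRing (seriesRing Q)
  open Statistics Q y x₁ x₂ x₃ x₄ using (avoidersSeries)
  open Formulas (seriesRing Q) (indeterminate Q) (constant Q y)
    (constant Q x₁) (constant Q x₂) (constant Q x₃) (constant Q x₄) using (Δ; D; N)

  -- The factor `1#` is the denominator of `fromSeries`: the equation is the equality of fractions
  -- after cross-multiplication.
  Claim : Set (c ⊔ ℓ)
  Claim = ∃ (IsSquareRoot Q Δ) × (∀ s → IsSquareRoot Q Δ s → avoidersSeries * D ≈ N s * 1#)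

module GeneratingFunction {c ℓ} (R : CommutativeRing c ℓ) (y x₁ x₂ x₃ x₄ : CommutativeRing.Carrier R) where
  open CommutativeRing R
  open Series R
  open TreeSeries R y x₁ x₂ x₃ x₄
  open WordWeights R y x₁ x₂ x₃ x₄
  open Statistics rawRing y x₁ x₂ x₃ x₄ using (weight) renaming (avoidersSeries to A)
  open IntegerSolver R
  private
    module S = CommutativeRing seriesCommutativeRing

    K = constant rawRing
    t = indeterminate rawRing

  ∑-↭ : ∀ {a} {A : Set a} (p : A → Carrier) {xs ys} → xs ↭ ys → ∑ p xs ≈ ∑ p ys
  ∑-↭ p ↭.refl         = refl
  ∑-↭ p (↭.prep x q)   = +-congˡ (∑-↭ p q)
  ∑-↭ p (↭.swap {xs} {ys} x z q) = begin
    p x + (p z + ∑ p xs)    ≈⟨ +-assoc _ _ _ ⟨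
    p x + p z + ∑ p xs      ≈⟨ +-cong (+-comm _ _) (∑-↭ p q) ⟩
    p z + p x + ∑ p ys      ≈⟨ +-assoc _ _ _ ⟩
    p z + (p x + ∑ p ys)    ∎
    where open SetoidReasoning setoid
  ∑-↭ p (↭.trans q q′) = trans (∑-↭ p q) (∑-↭ p q′)

  weight-tree : ∀ t → weight (word 0 t) ≈ isLeaf t + treeWeight bare t
  weight-tree leaf       = solve 0 (1ₛ′ :* 1ₛ′ :* 1ₛ′ :* 1ₛ′ :* 1ₛ′ := 1ₛ′ :+ con 0ℤ) refl
    where 1ₛ′ = con 1ℤ
  weight-tree t@(node l r) = trans
    (reflexive (≡.cong weight (≡.sym (List.++-identityʳ (word 0 t)))))
    (trans (weight-word 0 l r bare) (sym (+-identityˡ _)))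

  A-trees : A ≈ₛ 1ₛ +ₛ gf (treeWeight bare)
  A-trees n = begin
    ∑ weight (𝒮⟨ 1 ∷ 3 ∷ 2 ∷ [] ⟩ n)                      ≈⟨ ∑-↭ weight (words-of-trees↭ n) ⟨
    ∑ weight (map (word 0) (trees n))                     ≡⟨ ≡.cong (foldr _+_ 0#) (List.map-∘ (trees n)) ⟨
    ∑ (weight ∘ word 0) (trees n)                         ≈⟨ ∑-cong weight-tree (trees n) ⟩
    ∑ (λ t → isLeaf t + treeWeight bare t) (trees n)      ≈⟨ ∑-+ isLeaf (treeWeight bare) (trees n) ⟩
    gf isLeaf n + gf (treeWeight bare) n                  ≈⟨ +-congʳ (gf-isLeaf n) ⟩
    1ₛ n + gf (treeWeight bare) n                         ∎
    where open SetoidReasoning setoid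

  constant-homo : ∀ a b → K (a * b) ≈ₛ K a *ₛ K b
  constant-homo a b zero    = sym (constant-* a (K b) 0)
  constant-homo a b (suc n) = sym (trans (constant-* a (K b) (suc n)) (zeroʳ a))

  -- J is the unknown K of the equations.
  private
    E G H J : ℕ → Carrier
    E = gf (treeWeight right)
    G = gf (treeWeight left)
    H = gf (treeWeight left<right)
    J = gf (treeWeight left>right)

  open Formulas (seriesRing rawRing) t (K y) (K x₁) (K x₂) (K x₃) (K x₄) using (U; V; Equations; Solution; Δ; N)

  private
    equations : Equations A E G H J
    equations = record
      { A-eq = S.trans A-trees (S.+-congˡ (S.trans (gf-treeWeight bare) (S.*-congˡ {t} (S.+-congʳ
          (S.+-cong (S.+-congˡ (S.*-identityˡ E)) (S.*-identityˡ G))))))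
      ; E-eq = S.trans (gf-treeWeight right) (S.*-congˡ {t} (S.+-congʳ (S.+-congˡ (S.*-identityˡ H))))
      ; G-eq = S.trans (gf-treeWeight left) (S.*-congˡ {t} (S.+-congʳ
          (S.+-cong (S.+-congˡ (S.*-identityˡ J)) (S.*-congʳ (constant-homo y x₄)))))
      ; H-eq = S.trans (gf-treeWeight left<right) (S.*-congˡ {t} (S.+-congʳ
          (S.+-cong (S.+-congʳ (constant-homo y x₂)) (S.*-congʳ (constant-homo y x₄)))))
      ; K-eq = S.trans (gf-treeWeight left>right) (S.*-congˡ {t} (S.+-congʳ
          (S.+-congˡ (S.*-congʳ (constant-homo y x₄)))))
      }

    s₀ : ℕ → Carrier
    s₀ = U H +ₛ V J +ₛ -ₛ 1ₛ

    -- Unifying the two presentations of N directly is infeasible, hence the transport along refl.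
    solution : Solution A s₀
    solution = ≡.subst Solvable {S.rawRing} {seriesRing rawRing} ≡.refl (System.solvable seriesCommutativeRing)
      t (K y) (K x₁) (K x₂) (K x₃) (K x₄) A E G H J equations

  s₀-root : IsSquareRoot rawRing Δ s₀
  s₀-root = proj₁ solution , (begin
    -- Apart from the leading 1, every summand of `U` and `V` has a factor `t`, so the constant term
    -- is 1 + 1 - 1.
    1# - (t *ₛ K x₁) 0 - (t *ₛ K x₃ *ₛ H) 0 + (1# - (t *ₛ K y *ₛ K x₄) 0 - (t *ₛ K x₃ *ₛ J) 0) - 1#
      ≈⟨ +-congʳ (+-cong (+-cong (+-congˡ (-‿cong (shift-zero (K x₁)))) (-‿cong (vanishes (K x₃) H)))
           (+-cong (+-congˡ (-‿cong (vanishes (K y) (K x₄)))) (-‿cong (vanishes (K x₃) J)))) ⟩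
    1# - 0# - 0# + (1# - 0# - 0#) - 1#
      ≈⟨ solve 0 (1ₛ′ :- 0ₛ′ :- 0ₛ′ :+ (1ₛ′ :- 0ₛ′ :- 0ₛ′) :- 1ₛ′ := 1ₛ′) refl ⟩
    1# ∎)
    where
    open SetoidReasoning setoid
    0ₛ′ = con 0ℤ
    1ₛ′ = con 1ℤ

    vanishes : ∀ f g → (t *ₛ f *ₛ g) 0 ≈ 0#
    vanishes f g = trans (+-identityʳ _) (trans (*-congʳ (shift-zero f)) (zeroˡ _))

  claim : (∀ a → a + a ≈ 0# → a ≈ 0#) → Claim rawRing y x₁ x₂ x₃ x₄
  claim a+a≈0⇒a≈0 = (s₀ , s₀-root) , λ s root → S.trans
    (proj₂ solution (squareRoot-unique a+a≈0⇒a≈0 root s₀-root)) (S.sym (S.*-identityʳ (N s)))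

-- Specialisation to rational polynomials in five variables

open import Defs

private
  open Polynomials 5

  claim : Claim ℚ[y,x₁,x₂,x₃,x₄] (var 0F) (var 1F) (var 2F) (var 3F) (var 4F)
  -- The two raw rings agree by computation; transporting along `refl` compares the rings themselves
  -- instead of the formulas unfolded over them.
  claim = ≡.subst (λ R → ∀ y x₁ x₂ x₃ x₄ → Claim R y x₁ x₂ x₃ x₄)
    {CommutativeRing.rawRing polyCommutativeRing} {ℚ[y,x₁,x₂,x₃,x₄]} ≡.refl
    (λ y x₁ x₂ x₃ x₄ → GeneratingFunction.claim polyCommutativeRing y x₁ x₂ x₃ x₄ p+p≈0⇒p≈0)
    (var 0F) (var 1F) (var 2F) (var 3F) (var 4F)

theorem8 : ∃ (IsSquareRoot ℚ[y,x₁,x₂,x₃,x₄] Δ)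
    × (∀ √Δ → IsSquareRoot ℚ[y,x₁,x₂,x₃,x₄] Δ √Δ → fromSeries A ≃ N/D √Δ)
theorem8 = claim
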